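{- Let $k \ge 3$ be an integer, and let $f:\mathbb{N}\to\mathbb{C}$ be a multiplicative function such that \[ f(x_1^2 + x_2^2 + \dots + x_k^2) = f(x_1)^2 + f(x_2)^2 + \dots + f(x_k)^2 \] for all positive integers $x_1, x_2, \dots, x_k$. Then $f$ is the identity function, i.e. $f(n)=n$ for every positive integer $n$.
   Context: $\mathbb{N}$ denotes the set of positive integers. A function $f:\mathbb{N}\to\mathbb{C}$ is called multiplicative if $f(1)=1$ and $f(mn)=f(m)f(n)$ for all coprime positive integers $m$ and $n$. -}

module Defs where

open import Algebra.Bundles using (CommutativeMonoid)
open import Algebra.Bundles.Raw using (RawRing)
open import Data.Fin.Base using (Fin; zero; suc)
open import Data.Integer.Base using (+_)
open import Data.Nat.Base as ℕ using (ℕ; suc; NonZero)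
import Data.Nat.Properties as ℕ
open import Data.Nat.Coprimality using (Coprime)
open import Data.Product.Base using (_×_; _,_; ∃-syntax)
open import Data.Rational.Base as ℚ using (ℚ; Positive; 0ℚ; 1ℚ; ½; ∣_∣)
import Data.Rational.Properties as ℚ
open import Data.Rational.Solver using (module +-*-Solver)
open import Level using (0ℓ)
open import Relation.Binary.PropositionalEquality
  using (_≡_; refl; sym; trans; cong; subst)
import Algebra.Definitions.RawMonoid as RawMonoidDefs
import Algebra.Definitions.RawSemiring as RawSemiringDefs

record ℕ⁺ : Set where
  constructor mk⁺
  field
    value         : ℕ
    .{{positive}} : NonZero value

open ℕ⁺ public using (value)

1⁺ : ℕ⁺
1⁺ = mk⁺ 1

infixl 7 _*⁺_

_*⁺_ : ℕ⁺ → ℕ⁺ → ℕ⁺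
mk⁺ m *⁺ mk⁺ n = mk⁺ (m ℕ.* n) {{ℕ.m*n≢0 m n}}

open RawMonoidDefs ℕ.+-0-rawMonoid using () renaming (sum to sumℕ)

sumOfSquares-nonZero : ∀ {k} .{{_ : NonZero k}} (x : Fin k → ℕ⁺) →
                       NonZero (sumℕ (λ i → value (x i) ℕ.^ 2))
sumOfSquares-nonZero {suc k} x with x zero
... | mk⁺ (suc _) = _

sumOfSquares : ∀ {k} .{{_ : NonZero k}} → (Fin k → ℕ⁺) → ℕ⁺
sumOfSquares x = mk⁺ (sumℕ (λ i → value (x i) ℕ.^ 2)) {{sumOfSquares-nonZero x}}

-- The real numbers are the Cauchy sequences of rationals modulo null sequences.
-- The quotient is expressed by the equivalence relation _≈ℝ_.

IsCauchy : (ℕ → ℚ) → Set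
IsCauchy x = ∀ ε → .{{_ : Positive ε}} →
  ∃[ N ] ∀ m n → N ℕ.≤ m → N ℕ.≤ n → ∣ x m ℚ.- x n ∣ ℚ.< ε

record ℝ : Set where
  constructor mkℝ
  field
    seq    : ℕ → ℚ
    cauchy : IsCauchy seq

open ℝ public

infix 4 _≈ℝ_

record _≈ℝ_ (x y : ℝ) : Set where
  constructor mk≈ℝ
  field
    difference→0 : ∀ ε → .{{_ : Positive ε}} →
      ∃[ N ] ∀ n → N ℕ.≤ n → ∣ seq x n ℚ.- seq y n ∣ ℚ.< ε

open _≈ℝ_ public

module CauchyEstimates where

  half : ℚ → ℚ
  half ε = ε ℚ.* ½

  half-pos : ∀ ε → .{{Positive ε}} → Positive (half ε)
  half-pos ε = ℚ.pos*pos⇒pos ε ½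

  half+half : ∀ ε → half ε ℚ.+ half ε ≡ ε
  half+half ε = trans (sym (ℚ.*-distribˡ-+ ε ½ ½)) (ℚ.*-identityʳ ε)

  ∣p∣<∣q∣+1 : ∀ p q → ∣ p ℚ.- q ∣ ℚ.< 1ℚ → ∣ p ∣ ℚ.< ∣ q ∣ ℚ.+ 1ℚ
  ∣p∣<∣q∣+1 p q h = begin-strict
    ∣ p ∣                    ≡⟨ cong ∣_∣ (solve 2 (λ p q → p := q :+ (p :- q)) refl p q) ⟩
    ∣ q ℚ.+ (p ℚ.- q) ∣      ≤⟨ ℚ.∣p+q∣≤∣p∣+∣q∣ q (p ℚ.- q) ⟩
    ∣ q ∣ ℚ.+ ∣ p ℚ.- q ∣    <⟨ ℚ.+-monoʳ-< ∣ q ∣ h ⟩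
    ∣ q ∣ ℚ.+ 1ℚ             ∎
    where open ℚ.≤-Reasoning
          open +-*-Solver

  +1-pos : ∀ p → Positive (∣ p ∣ ℚ.+ 1ℚ)
  +1-pos p = ℚ.nonNeg+pos⇒pos ∣ p ∣ {{ℚ.∣-∣-nonNeg p}} 1ℚ

  eventuallyBounded : ∀ x → IsCauchy x →
    ∃[ B ] Positive B × ∃[ N ] ∀ n → N ℕ.≤ n → ∣ x n ∣ ℚ.< B
  eventuallyBounded x cx with cx 1ℚ
  ... | N , h = ∣ x N ∣ ℚ.+ 1ℚ , +1-pos (x N) , N ,
                λ n N≤n → ∣p∣<∣q∣+1 (x n) (x N) (h n N N≤n ℕ.≤-refl)

  δ : ∀ B .{{_ : Positive B}} → ℚ → ℚ
  δ B ε = ε ℚ.* (ℚ.1/ B) {{ℚ.pos⇒nonZero B}}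

  δ-pos : ∀ B .{{_ : Positive B}} ε .{{_ : Positive ε}} → Positive (δ B ε)
  δ-pos B ε = ℚ.pos*pos⇒pos ε _ {{ℚ.1/pos⇒pos B}}

  scaled-< : ∀ B .{{_ : Positive B}} ε .{{_ : Positive ε}} p q →
             ∣ p ∣ ℚ.< B → ∣ q ∣ ℚ.< δ B ε → ∣ p ℚ.* q ∣ ℚ.< ε
  scaled-< B ε p q p<B q<δ = begin-strict
    ∣ p ℚ.* q ∣       ≡⟨ ℚ.∣p*q∣≡∣p∣*∣q∣ p q ⟩
    ∣ p ∣ ℚ.* ∣ q ∣   ≤⟨ ℚ.*-monoʳ-≤-nonNeg ∣ q ∣ {{ℚ.∣-∣-nonNeg q}} (ℚ.<⇒≤ p<B) ⟩
    B ℚ.* ∣ q ∣       <⟨ ℚ.*-monoʳ-<-pos B q<δ ⟩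
    B ℚ.* (ε ℚ.* B⁻¹) ≡⟨ x∙yz≈y∙xz B ε B⁻¹ ⟩
    ε ℚ.* (B ℚ.* B⁻¹) ≡⟨ cong (ε ℚ.*_) (ℚ.*-inverseʳ B {{B≢0}}) ⟩
    ε ℚ.* 1ℚ          ≡⟨ ℚ.*-identityʳ ε ⟩
    ε                 ∎
    where open ℚ.≤-Reasoning
          open import Algebra.Properties.CommutativeSemigroup
            (CommutativeMonoid.commutativeSemigroup ℚ.*-1-commutativeMonoid) using (x∙yz≈y∙xz)
          B≢0 = ℚ.pos⇒nonZero B
          B⁻¹ = (ℚ.1/ B) {{B≢0}}

  +-<-half : ∀ ε p q → ∣ p ∣ ℚ.< half ε → ∣ q ∣ ℚ.< half ε → ∣ p ℚ.+ q ∣ ℚ.< ε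
  +-<-half ε p q hp hq = begin-strict
    ∣ p ℚ.+ q ∣        ≤⟨ ℚ.∣p+q∣≤∣p∣+∣q∣ p q ⟩
    ∣ p ∣ ℚ.+ ∣ q ∣    <⟨ ℚ.+-mono-< hp hq ⟩
    half ε ℚ.+ half ε  ≡⟨ half+half ε ⟩
    ε                  ∎
    where open ℚ.≤-Reasoning

  *-difference : ∀ a b c d → a ℚ.* (c ℚ.- d) ℚ.+ d ℚ.* (a ℚ.- b) ≡ a ℚ.* c ℚ.- b ℚ.* d
  *-difference = solve 4 (λ a b c d → a :* (c :- d) :+ d :* (a :- b) := a :* c :- b :* d) refl
    where open +-*-Solver

  *-close : ∀ A .{{_ : Positive A}} B .{{_ : Positive B}} ε .{{_ : Positive ε}} a b c d →
            ∣ a ∣ ℚ.< A → ∣ d ∣ ℚ.< B →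
            ∣ a ℚ.- b ∣ ℚ.< δ B (half ε) → ∣ c ℚ.- d ∣ ℚ.< δ A (half ε) →
            ∣ a ℚ.* c ℚ.- b ℚ.* d ∣ ℚ.< ε
  *-close A B ε a b c d a<A d<B a~b c~d =
    subst (λ q → ∣ q ∣ ℚ.< ε) (*-difference a b c d)
      (+-<-half ε (a ℚ.* (c ℚ.- d)) (d ℚ.* (a ℚ.- b))
        (scaled-< A (half ε) {{half-pos ε}} a (c ℚ.- d) a<A c~d)
        (scaled-< B (half ε) {{half-pos ε}} d (a ℚ.- b) d<B a~b))

  -- Abstract, because normalising these proofs is very expensive.
  abstract
    const-cauchy : ∀ q → IsCauchy (λ _ → q)
    const-cauchy q ε = 0 , λ _ _ _ _ →
      subst (λ d → ∣ d ∣ ℚ.< ε) (sym (ℚ.+-inverseʳ q)) (ℚ.positive⁻¹ ε)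

    +-cauchy : ∀ x y → IsCauchy x → IsCauchy y → IsCauchy (λ n → x n ℚ.+ y n)
    +-cauchy x y cx cy ε
      with cx (half ε) {{half-pos ε}} | cy (half ε) {{half-pos ε}}
    ... | M , hx | N , hy = M ℕ.⊔ N , λ m n m≥ n≥ →
      subst (λ d → ∣ d ∣ ℚ.< ε)
        (solve 4 (λ a b c d → (a :- b) :+ (c :- d) := (a :+ c) :- (b :+ d))
          refl (x m) (x n) (y m) (y n))
        (+-<-half ε (x m ℚ.- x n) (y m ℚ.- y n)
          (hx m n (ℕ.m⊔n≤o⇒m≤o M N m≥) (ℕ.m⊔n≤o⇒m≤o M N n≥))
          (hy m n (ℕ.m⊔n≤o⇒n≤o M N m≥) (ℕ.m⊔n≤o⇒n≤o M N n≥)))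
      where open +-*-Solver

    neg-cauchy : ∀ x → IsCauchy x → IsCauchy (λ n → ℚ.- x n)
    neg-cauchy x cx ε with cx ε
    ... | N , h = N , λ m n m≥ n≥ →
      subst (λ d → ∣ d ∣ ℚ.< ε)
        (solve 2 (λ a b → b :- a := (:- a) :- (:- b)) refl (x m) (x n))
        (h n m n≥ m≥)
      where open +-*-Solver

    *-cauchy : ∀ x y → IsCauchy x → IsCauchy y → IsCauchy (λ n → x n ℚ.* y n)
    *-cauchy x y cx cy ε =
      let A , A>0 , K , x<A = eventuallyBounded x cx
          B , B>0 , L , y<B = eventuallyBounded y cy
          M , hx = cx (δ B {{B>0}} (half ε)) {{δ-pos B {{B>0}} (half ε) {{half-pos ε}}}}
          N , hy = cy (δ A {{A>0}} (half ε)) {{δ-pos A {{A>0}} (half ε) {{half-pos ε}}}}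
      in (K ℕ.⊔ L) ℕ.⊔ (M ℕ.⊔ N) , λ m n m≥ n≥ →
        let KL≤m = ℕ.m⊔n≤o⇒m≤o (K ℕ.⊔ L) (M ℕ.⊔ N) m≥
            MN≤m = ℕ.m⊔n≤o⇒n≤o (K ℕ.⊔ L) (M ℕ.⊔ N) m≥
            KL≤n = ℕ.m⊔n≤o⇒m≤o (K ℕ.⊔ L) (M ℕ.⊔ N) n≥
            MN≤n = ℕ.m⊔n≤o⇒n≤o (K ℕ.⊔ L) (M ℕ.⊔ N) n≥
        in *-close A {{A>0}} B {{B>0}} ε (x m) (x n) (y m) (y n)
             (x<A m (ℕ.m⊔n≤o⇒m≤o K L KL≤m))
             (y<B n (ℕ.m⊔n≤o⇒n≤o K L KL≤n))
             (hx m n (ℕ.m⊔n≤o⇒m≤o M N MN≤m) (ℕ.m⊔n≤o⇒m≤o M N MN≤n))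
             (hy m n (ℕ.m⊔n≤o⇒n≤o M N MN≤m) (ℕ.m⊔n≤o⇒n≤o M N MN≤n))

open CauchyEstimates

infixl 6 _+ℝ_ _-ℝ_
infixl 7 _*ℝ_
infix  8 -ℝ_

fromℚ : ℚ → ℝ
fromℚ q = mkℝ (λ _ → q) (const-cauchy q)

_+ℝ_ : ℝ → ℝ → ℝ
mkℝ x cx +ℝ mkℝ y cy = mkℝ (λ n → x n ℚ.+ y n) (+-cauchy x y cx cy)

_*ℝ_ : ℝ → ℝ → ℝ
mkℝ x cx *ℝ mkℝ y cy = mkℝ (λ n → x n ℚ.* y n) (*-cauchy x y cx cy)

-ℝ_ : ℝ → ℝ
-ℝ mkℝ x cx = mkℝ (λ n → ℚ.- x n) (neg-cauchy x cx)

_-ℝ_ : ℝ → ℝ → ℝ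
x -ℝ y = x +ℝ (-ℝ y)

record ℂ : Set where
  constructor _+i_
  field
    re im : ℝ

open ℂ public

infix 4 _≈ℂ_

record _≈ℂ_ (z w : ℂ) : Set where
  constructor mk≈ℂ
  field
    re≈ : re z ≈ℝ re w
    im≈ : im z ≈ℝ im w

open _≈ℂ_ public

fromℝ : ℝ → ℂ
fromℝ x = x +i fromℚ 0ℚ

ℂ-rawRing : RawRing 0ℓ 0ℓ
ℂ-rawRing = record
  { Carrier = ℂ
  ; _≈_     = _≈ℂ_
  ; _+_     = λ z w → (re z +ℝ re w) +i (im z +ℝ im w)
  ; _*_     = λ z w → (re z *ℝ re w -ℝ im z *ℝ im w) +i (re z *ℝ im w +ℝ im z *ℝ re w)
  ; -_      = λ z → (-ℝ re z) +i (-ℝ im z)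
  ; 0#      = fromℝ (fromℚ 0ℚ)
  ; 1#      = fromℝ (fromℚ 1ℚ)
  }

open RawRing ℂ-rawRing public using () renaming
  (_+_ to _+ℂ_; _*_ to _*ℂ_; -_ to -ℂ_; 0# to 0ℂ; 1# to 1ℂ)
open RawSemiringDefs (RawRing.rawSemiring ℂ-rawRing) public using () renaming
  (sum to sumℂ; _^_ to _^ℂ_)

fromℕ⁺ : ℕ⁺ → ℂ
fromℕ⁺ n = fromℝ (fromℚ (+ value n ℚ./ 1))

record IsMultiplicative (f : ℕ⁺ → ℂ) : Set where
  field
    1-homo : f 1⁺ ≈ℂ 1ℂ
    *-homo : ∀ m n → Coprime (value m) (value n) → f (m *⁺ n) ≈ℂ f m *ℂ f n

{-# OPTIONS --safe #-}

-- Write F(n) = f(n)² and D(n) = F(n) − n². The sum of D over k arguments depends only on the sum of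
-- their squares. Trading squares in identities such as 1² + 1² + 5² = 3² + 3² + 3² and
--   (2m + 1)² + (m − 2)² = (2m − 1)² + (m + 2)²,   (2m + 2)² + (m − 4)² = (2m − 2)² + (m + 4)²
-- shows that D is determined by D(2) and D(3) (D(1) is zero). These vanish because D(k) = 0 and, if
-- k ≥ 4, because 5² + 1² + 1² + 1² = 4² + 2² + 2² + 2², if k = 3, because F(6) = F(2) F(3). Hence
-- F(n) = n², and f(n) = n whenever n is a sum of k positive squares.
--
-- For arbitrary n it suffices to find m coprime to n with f(m) = m and f(nm) = nm. For k ≥ 5 every large
-- number is a sum of k positive squares by Lagrange's theorem; for k = 4 such an m comes from Euler's
-- four-square identity. For k = 3 induction reduces to n = p^e with e odd, where a multiple pm with
-- m < p has the form x² + y² + 1.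

module Submission where

open import Defs
open import Data.Fin.Base using (Fin)
open import Data.Nat.Base using (ℕ; _≤_; z≤n; s≤s; >-nonZero)
open import Data.Nat.Properties using (≤-trans)

open import Algebra.Bundles using (CommutativeRing)
open import Algebra.Bundles.Raw using (RawRing)
import Algebra.Definitions.RawMonoid
import Algebra.Definitions.RawSemiring
import Algebra.Properties.CommutativeMonoid.Mult
import Algebra.Properties.CommutativeMonoid.Sum
import Algebra.Properties.CommutativeSemiring.Exp
import Algebra.Properties.Group
import Algebra.Properties.Semiring.Mult
open import Algebra.Structures using (IsCommutativeRing)
import Data.Nat.Base as ℕ
open import Data.Nat.Base using (zero; suc; NonZero; _<_)
open import Data.Nat.Coprimality as Coprime using (Coprime)
open import Data.Nat.Induction using (<-rec)
import Data.Nat.Properties as ℕ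
open import Data.Nat.Tactic.RingSolver using (solve-∀)
open import Data.Product.Base using (_×_; _,_; ∃-syntax; ∃₂)
open import Data.Sum.Base using (_⊎_; inj₁; inj₂)
open import Data.Vec.Base using (Vec; []; _∷_; _++_; lookup; replicate)
open import Function.Base using (_∘_; it)
open import Level using (Level; 0ℓ)
open import Relation.Binary.PropositionalEquality as ≡ using (_≡_; refl)
open import Relation.Nullary using (contradiction)

-- Sums of squares of natural numbers

-- All terms of the given sums are positive, whereas Lagrange's theorem and the congruence x² + y² +
-- 1 ≡ 0 modulo p may produce zeros. Removing the zeros is what the special constants are for: 169 =
-- 13² makes up for missing terms if k ≥ 5, a quaternion without zero coordinates is the multiplier
-- if k = 4, and a factor 9 splits x² + 1 into three positive squares if k = 3. Equality of complex
-- numbers says that differences of rational sequences tend to 0, so it is not decided anywhere, and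
-- there is no division by values of f. Every cancellation is by a positive integer instead: once
-- f(m) = m, the equation f(n) f(m) = f(nm) = nm reads m f(n) = mn. This is why the values of f are
-- taken in an arbitrary torsion-free commutative ring, and why the passage from F(n) = n² to f(n) =
-- n never extracts a square root.

module SumsOfSquares where

  open import Data.Nat.Properties
  open import Data.Fin.Base using (toℕ; fromℕ<; splitAt; join)
  open import Data.Fin.Properties using (pigeonhole; toℕ<n; toℕ-injective; fromℕ<-injective; join-splitAt)
  import Data.Fin.Properties as Fin
  open import Data.Integer.Base as ℤ using (ℤ; +_; 0ℤ; 1ℤ) renaming (∣_∣ to abs)
  open import Data.Integer.DivMod using (_%ℕ_; _/ℕ_; n%ℕd<d; a≡a%ℕn+[a/ℕn]*n)
  import Data.Integer.Divisibility.Signed as ℤ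
  import Data.Integer.Properties as ℤ
  import Data.Integer.Tactic.RingSolver as ℤ
  open import Data.List.Base using ([]; _∷_)
  open import Data.List.Relation.Unary.All using (All; []; _∷_)
  open import Data.Nat.Base
  open import Algebra.Definitions.RawMonoid +-0-rawMonoid using () renaming (sum to sumℕ)
  open import Data.Nat.Divisibility
  open import Data.Nat.ListAction using (product)
  open import Data.Nat.Primality
  open import Data.Nat.Primality.Factorisation using (factorise; module PrimeFactorisation)
  open import Data.Vec.Base using (map)
  open import Relation.Nullary using (¬_; Dec; yes; no)
  open import Relation.Nullary.Decidable using (toWitness; toWitnessFalse)
  open ≡ using (_≢_; sym; trans; cong; cong₂; subst; module ≡-Reasoning)

  -- Solving x² + y² + 1 ≡ 0 modulo an odd prime

  sameResidue⇒∣- : ∀ a b p .{{_ : NonZero p}} → a %ℕ p ≡ b %ℕ p → + p ℤ.∣ a ℤ.- b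
  sameResidue⇒∣- a b p eq = ℤ.divides (a /ℕ p ℤ.- b /ℕ p) (begin
    a ℤ.- b
      ≡⟨ cong₂ ℤ._-_ (a≡a%ℕn+[a/ℕn]*n a p) (a≡a%ℕn+[a/ℕn]*n b p) ⟩
    (+ (a %ℕ p) ℤ.+ a /ℕ p ℤ.* + p) ℤ.- (+ (b %ℕ p) ℤ.+ b /ℕ p ℤ.* + p)
      ≡⟨ cong (λ r → (+ r ℤ.+ a /ℕ p ℤ.* + p) ℤ.- (+ (b %ℕ p) ℤ.+ b /ℕ p ℤ.* + p)) eq ⟩
    (+ (b %ℕ p) ℤ.+ a /ℕ p ℤ.* + p) ℤ.- (+ (b %ℕ p) ℤ.+ b /ℕ p ℤ.* + p)
      ≡⟨ identity (+ (b %ℕ p)) (a /ℕ p) (b /ℕ p) (+ p) ⟩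
    (a /ℕ p ℤ.- b /ℕ p) ℤ.* + p ∎)
    where
    open ≡-Reasoning
    identity : ∀ r s t p → (r ℤ.+ s ℤ.* p) ℤ.- (r ℤ.+ t ℤ.* p) ≡ (s ℤ.- t) ℤ.* p
    identity = ℤ.solve-∀

  -- By Euclid's lemma `p` divides |i - j| or i + j. Both are at most 2h < p, so the one divisible
  -- by `p` is 0; for i + j this leaves i = j = 0.
  squares-incongruent : ∀ {p h i j} → Prime p → h + h < p → i ≤ h → j ≤ h →
                        + p ℤ.∣ + i ℤ.* + i ℤ.- + j ℤ.* + j → i ≡ j
  squares-incongruent {p} {h} {i} {j} p-prime 2h<p i≤h j≤h p∣i²-j² =
    cases (euclidsLemma (abs (+ i ℤ.- + j)) (i + j) p-prime p∣∣i-j∣*[i+j])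
    where
    identity : ∀ a b → a ℤ.* a ℤ.- b ℤ.* b ≡ (a ℤ.- b) ℤ.* (a ℤ.+ b)
    identity = ℤ.solve-∀
    p∣∣i-j∣*[i+j] : p ∣ abs (+ i ℤ.- + j) * (i + j)
    p∣∣i-j∣*[i+j] = subst (p ∣_) (trans (cong abs (identity (+ i) (+ j))) (ℤ.abs-* (+ i ℤ.- + j) (+ (i + j))))
                      (ℤ.∣⇒∣ᵤ p∣i²-j²)
    ∣<⇒≡0 : ∀ {n} → p ∣ n → n < p → n ≡ 0
    ∣<⇒≡0 {zero}  _   _   = refl
    ∣<⇒≡0 {suc _} p∣n n<p = contradiction (∣⇒≤ p∣n) (<⇒≱ n<p)
    ∣i-j∣<p : abs (+ i ℤ.- + j) < p
    ∣i-j∣<p = begin-strict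
      abs (+ i ℤ.- + j) ≡⟨ cong abs (ℤ.m-n≡m⊖n i j) ⟩
      abs (i ℤ.⊖ j)     ≤⟨ ℤ.∣m⊝n∣≤m⊔n i j ⟩
      i ⊔ j             ≤⟨ ⊔-lub i≤h j≤h ⟩
      h                 ≤⟨ m≤m+n h h ⟩
      h + h             <⟨ 2h<p ⟩
      p                 ∎
      where open ≤-Reasoning
    cases : p ∣ abs (+ i ℤ.- + j) ⊎ p ∣ i + j → i ≡ j
    cases (inj₁ p∣i-j) = ℤ.+-injective (ℤ.i-j≡0⇒i≡j (+ i) (+ j) (ℤ.∣i∣≡0⇒i≡0 (∣<⇒≡0 p∣i-j ∣i-j∣<p)))
    cases (inj₂ p∣i+j) = trans (m+n≡0⇒m≡0 i i+j≡0) (sym (m+n≡0⇒n≡0 i i+j≡0))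
      where i+j≡0 = ∣<⇒≡0 p∣i+j (≤-<-trans (+-mono-≤ i≤h j≤h) 2h<p)

  square : ∀ {n} → Fin n → ℤ
  square i = + toℕ i ℤ.* + toℕ i

  candidate : ∀ {m n} → Fin m ⊎ Fin n → ℤ
  candidate (inj₁ i) = square i
  candidate (inj₂ j) = ℤ.- (1ℤ ℤ.+ square j)

  -- Among the 2h + 2 residues of i² and −1 − j² with i, j ≤ h two agree modulo p = 2h + 1,
  -- and the squares of 0, …, h are pairwise incongruent.
  p∣x²+y²+1 : ∀ {p h} → Prime p → p ≡ suc (h + h) →
              ∃₂ λ x y → x ≤ h × y ≤ h × p ∣ x * x + y * y + 1
  p∣x²+y²+1 {p} {h} p-prime refl
    with pigeonhole p<2h+2 (λ i → fromℕ< (n%ℕd<d (candidate (splitAt (suc h) i)) p))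
    where
    p<2h+2 : p < suc h + suc h
    p<2h+2 = s≤s (≤-reflexive (sym (+-suc h h)))
  ... | s , t , s<t , same = collision (splitAt (suc h) s) (splitAt (suc h) t) s≢t
          (sameResidue⇒∣- (candidate (splitAt (suc h) s)) (candidate (splitAt (suc h) t)) p
            (fromℕ<-injective _ _ _ _ same))
    where
    s≢t : splitAt (suc h) s ≢ splitAt (suc h) t
    s≢t eq = Fin.<⇒≢ {i = s} {j = t} s<t (trans (sym (join-splitAt (suc h) (suc h) s))
      (trans (cong (join (suc h) (suc h)) eq) (join-splitAt (suc h) (suc h) t)))
    ≤h : (i : Fin (suc h)) → toℕ i ≤ h
    ≤h i = s≤s⁻¹ (toℕ<n i)
    distinct : ∀ {i j : Fin (suc h)} → i ≢ j → ¬ + p ℤ.∣ square i ℤ.- square j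
    distinct {i} {j} i≢j p∣ = i≢j (toℕ-injective (squares-incongruent p-prime ≤-refl (≤h i) (≤h j) p∣))
    mixed : (i j : Fin (suc h)) → + p ℤ.∣ square i ℤ.- ℤ.- (1ℤ ℤ.+ square j) →
            ∃₂ λ x y → x ≤ h × y ≤ h × p ∣ x * x + y * y + 1
    mixed i j p∣ = toℕ i , toℕ j , ≤h i , ≤h j , ℤ.∣⇒∣ᵤ (subst (+ p ℤ.∣_) eq p∣)
      where
      identity : ∀ a b → a ℤ.- ℤ.- (1ℤ ℤ.+ b) ≡ a ℤ.+ b ℤ.+ 1ℤ
      identity = ℤ.solve-∀
      eq : square i ℤ.- ℤ.- (1ℤ ℤ.+ square j) ≡ + (toℕ i * toℕ i + toℕ j * toℕ j + 1)
      eq = trans (identity (square i) (square j))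
        (cong₂ (λ u v → u ℤ.+ v ℤ.+ 1ℤ) (sym (ℤ.pos-* (toℕ i) (toℕ i))) (sym (ℤ.pos-* (toℕ j) (toℕ j))))
    swap : ∀ a b → ℤ.- (a ℤ.- b) ≡ b ℤ.- a
    swap = ℤ.solve-∀
    collision : ∀ a b → a ≢ b → + p ℤ.∣ candidate a ℤ.- candidate b →
                ∃₂ λ x y → x ≤ h × y ≤ h × p ∣ x * x + y * y + 1
    collision (inj₁ i) (inj₁ j) a≢b p∣ = contradiction p∣ (distinct (a≢b ∘ cong inj₁))
    collision (inj₁ i) (inj₂ j) _   p∣ = mixed i j p∣
    collision (inj₂ j) (inj₁ i) _   p∣ =
      mixed i j (subst (+ p ℤ.∣_) (swap (ℤ.- (1ℤ ℤ.+ square j)) (square i)) (ℤ.∣m⇒∣-m p∣))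
    collision (inj₂ i) (inj₂ j) a≢b p∣ =
      contradiction (subst (+ p ℤ.∣_) (identity (square i) (square j)) p∣) (distinct (a≢b ∘ cong inj₂ ∘ sym))
      where
      identity : ∀ a b → ℤ.- (1ℤ ℤ.+ a) ℤ.- ℤ.- (1ℤ ℤ.+ b) ≡ b ℤ.- a
      identity = ℤ.solve-∀

  -- Lagrange's four-square theorem

  norm : (a b c d : ℤ) → ℤ
  norm a b c d = a ℤ.* a ℤ.+ b ℤ.* b ℤ.+ c ℤ.* c ℤ.+ d ℤ.* d

  -- The coordinates are integers because Euler's identity produces differences; `sumOfFourSquares`
  -- returns to ℕ by absolute values.
  IsNorm : ℕ → Set
  IsNorm n = ∃[ a ] ∃[ b ] ∃[ c ] ∃[ d ] + n ≡ norm a b c d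

  dot : (a b c d x y z w : ℤ) → ℤ
  dot a b c d x y z w = a ℤ.* x ℤ.+ b ℤ.* y ℤ.+ c ℤ.* z ℤ.+ d ℤ.* w

  -- An imaginary component of the quaternion βᾱ, where α = a + bi + cj + dk and β = x + yi + zj +
  -- wk. Cycling (b, c, d) together with (y, z, w) gives the other two; the real part is `dot`.
  cross : (a b c d x y z w : ℤ) → ℤ
  cross a b c d x y z w = a ℤ.* y ℤ.- b ℤ.* x ℤ.+ c ℤ.* w ℤ.- d ℤ.* z

  -- Euler's four-square identity |α|²|β|² = |βᾱ|².
  norm-* : ∀ a b c d x y z w →
    norm a b c d ℤ.* norm x y z w ≡
    norm (dot a b c d x y z w) (cross a b c d x y z w) (cross a c d b x z w y) (cross a d b c x w y z)
  norm-* = identity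
    where
    identity : ∀ a b c d x y z w →
      (a ℤ.* a ℤ.+ b ℤ.* b ℤ.+ c ℤ.* c ℤ.+ d ℤ.* d) ℤ.* (x ℤ.* x ℤ.+ y ℤ.* y ℤ.+ z ℤ.* z ℤ.+ w ℤ.* w) ≡
      (a ℤ.* x ℤ.+ b ℤ.* y ℤ.+ c ℤ.* z ℤ.+ d ℤ.* w) ℤ.* (a ℤ.* x ℤ.+ b ℤ.* y ℤ.+ c ℤ.* z ℤ.+ d ℤ.* w) ℤ.+
      (a ℤ.* y ℤ.- b ℤ.* x ℤ.+ c ℤ.* w ℤ.- d ℤ.* z) ℤ.* (a ℤ.* y ℤ.- b ℤ.* x ℤ.+ c ℤ.* w ℤ.- d ℤ.* z) ℤ.+
      (a ℤ.* z ℤ.- c ℤ.* x ℤ.+ d ℤ.* y ℤ.- b ℤ.* w) ℤ.* (a ℤ.* z ℤ.- c ℤ.* x ℤ.+ d ℤ.* y ℤ.- b ℤ.* w) ℤ.+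
      (a ℤ.* w ℤ.- d ℤ.* x ℤ.+ b ℤ.* z ℤ.- c ℤ.* y) ℤ.* (a ℤ.* w ℤ.- d ℤ.* x ℤ.+ b ℤ.* z ℤ.- c ℤ.* y)
    identity = ℤ.solve-∀

  balancedResidue : ∀ a m .{{_ : NonZero m}} →
                    ∃₂ λ b c → a ≡ b ℤ.+ + m ℤ.* c × 2 * abs b ≤ m
  balancedResidue a m with 2 * (a %ℕ m) ≤? m
  ... | yes 2r≤m = + (a %ℕ m) , a /ℕ m ,
    trans (a≡a%ℕn+[a/ℕn]*n a m) (cong (ℤ._+_ (+ (a %ℕ m))) (ℤ.*-comm (a /ℕ m) (+ m))) , 2r≤m
  ... | no 2r≰m = + r ℤ.- + m , 1ℤ ℤ.+ a /ℕ m , trans (a≡a%ℕn+[a/ℕn]*n a m) (identity (+ r) (a /ℕ m) (+ m)) ,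
    (begin
      2 * abs (+ r ℤ.- + m) ≡⟨ cong (λ x → 2 * abs x) (trans (ℤ.m-n≡m⊖n r m) (ℤ.⊖-≤ r≤m)) ⟩
      2 * abs (ℤ.- + (m ∸ r)) ≡⟨ cong (2 *_) (ℤ.∣-i∣≡∣i∣ (+ (m ∸ r))) ⟩
      2 * (m ∸ r)           ≡⟨ *-distribˡ-∸ 2 m r ⟩
      2 * m ∸ 2 * r         ≤⟨ ∸-monoʳ-≤ (2 * m) (<⇒≤ (≰⇒> 2r≰m)) ⟩
      2 * m ∸ m             ≡⟨ m+n∸m≡n m (m + 0) ⟩
      m + 0                 ≡⟨ +-identityʳ m ⟩
      m                     ∎)
    where
    open ≤-Reasoning
    r = a %ℕ m
    r≤m = <⇒≤ (n%ℕd<d a m)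
    identity : ∀ r q m → r ℤ.+ q ℤ.* m ≡ (r ℤ.- m) ℤ.+ m ℤ.* (1ℤ ℤ.+ q)
    identity = ℤ.solve-∀

  -- No square exceeds m², so x < m would push the sum below 4m². With x = 2|bᵢ| this settles the
  -- extreme case r = m of the descent.
  ≤∧Σ²≡4m²⇒≡m : ∀ {m x y z w} → x ≤ m → y ≤ m → z ≤ m → w ≤ m →
                 x * x + (y * y + z * z + w * w) ≡ m * m + (m * m + m * m + m * m) → x ≡ m
  ≤∧Σ²≡4m²⇒≡m {m} {x} x≤m y≤m z≤m w≤m eq with x ≟ m
  ... | yes x≡m = x≡m
  ... | no  x≢m = contradiction eq (<⇒≢ (+-mono-<-≤ (*-mono-< x<m x<m)
                    (+-mono-≤ (+-mono-≤ (*-mono-≤ y≤m y≤m) (*-mono-≤ z≤m z≤m)) (*-mono-≤ w≤m w≤m))))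
    where x<m = ≤∧≢⇒< x≤m x≢m

  i*i≡+∣i∣² : ∀ i → i ℤ.* i ≡ + (abs i * abs i)
  i*i≡+∣i∣² (+ n)      = sym (ℤ.pos-* n n)
  i*i≡+∣i∣² ℤ.-[1+ n ] = refl

  norm≡+Σ∣∣² : ∀ a b c d →
    norm a b c d ≡ + (abs a * abs a + abs b * abs b + abs c * abs c + abs d * abs d)
  norm≡+Σ∣∣² a b c d =
    cong₂ ℤ._+_ (cong₂ ℤ._+_ (cong₂ ℤ._+_ (i*i≡+∣i∣² a) (i*i≡+∣i∣² b)) (i*i≡+∣i∣² c)) (i*i≡+∣i∣² d)

  m∣2∣b∣⇒m∣2b : ∀ {m} b → m ∣ 2 * abs b → + m ℤ.∣ + 2 ℤ.* b
  m∣2∣b∣⇒m∣2b {m} b m∣ = ℤ.∣ᵤ⇒∣ (subst (m ∣_) (sym (ℤ.abs-* (+ 2) b)) m∣)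

  norm-+* : ∀ m a b c d x y z w →
    norm (a ℤ.+ m ℤ.* x) (b ℤ.+ m ℤ.* y) (c ℤ.+ m ℤ.* z) (d ℤ.+ m ℤ.* w) ≡
    norm a b c d ℤ.+ m ℤ.* (+ 2 ℤ.* dot a b c d x y z w ℤ.+ m ℤ.* norm x y z w)
  norm-+* = identity
    where
    identity : ∀ m b₀ b₁ b₂ b₃ c₀ c₁ c₂ c₃ →
      (b₀ ℤ.+ m ℤ.* c₀) ℤ.* (b₀ ℤ.+ m ℤ.* c₀) ℤ.+ (b₁ ℤ.+ m ℤ.* c₁) ℤ.* (b₁ ℤ.+ m ℤ.* c₁) ℤ.+
      (b₂ ℤ.+ m ℤ.* c₂) ℤ.* (b₂ ℤ.+ m ℤ.* c₂) ℤ.+ (b₃ ℤ.+ m ℤ.* c₃) ℤ.* (b₃ ℤ.+ m ℤ.* c₃) ≡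
      (b₀ ℤ.* b₀ ℤ.+ b₁ ℤ.* b₁ ℤ.+ b₂ ℤ.* b₂ ℤ.+ b₃ ℤ.* b₃) ℤ.+
      m ℤ.* (+ 2 ℤ.* (b₀ ℤ.* c₀ ℤ.+ b₁ ℤ.* c₁ ℤ.+ b₂ ℤ.* c₂ ℤ.+ b₃ ℤ.* c₃) ℤ.+
             m ℤ.* (c₀ ℤ.* c₀ ℤ.+ c₁ ℤ.* c₁ ℤ.+ c₂ ℤ.* c₂ ℤ.+ c₃ ℤ.* c₃))
    identity = ℤ.solve-∀

  -- The classical descent divides the quaternion αβ̄ by m, where α = β + mγ and |β|² = mr. The
  -- quotient is r + γβ̄, whose coordinates r + b·c and the three cross terms are visibly integers,
  -- and whose norm is pm · mr / m² = pr.
  isNorm-shift : ∀ {p m r} b₀ b₁ b₂ b₃ c₀ c₁ c₂ c₃ →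
    + p ≡ + r ℤ.+ (+ 2 ℤ.* dot b₀ b₁ b₂ b₃ c₀ c₁ c₂ c₃ ℤ.+ + m ℤ.* norm c₀ c₁ c₂ c₃) →
    norm b₀ b₁ b₂ b₃ ≡ + m ℤ.* + r → IsNorm (p * r)
  isNorm-shift {p} {m} {r} b₀ b₁ b₂ b₃ c₀ c₁ c₂ c₃ p≡ ∣b∣²≡mr =
    + r ℤ.+ b·c , x , y , z , (begin
      + (p * r)                                                         ≡⟨ ℤ.pos-* p r ⟩
      + p ℤ.* + r                                                       ≡⟨ cong (ℤ._* + r) p≡ ⟩
      (+ r ℤ.+ (+ 2 ℤ.* b·c ℤ.+ + m ℤ.* ∣c∣²)) ℤ.* + r                  ≡⟨ regroup (+ r) b·c (+ m) ∣c∣² ⟩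
      (+ r ℤ.* + r ℤ.+ + 2 ℤ.* (+ r ℤ.* b·c)) ℤ.+ + m ℤ.* + r ℤ.* ∣c∣²
        ≡⟨ cong (λ n → (+ r ℤ.* + r ℤ.+ + 2 ℤ.* (+ r ℤ.* b·c)) ℤ.+ n ℤ.* ∣c∣²) ∣b∣²≡mr ⟨
      (+ r ℤ.* + r ℤ.+ + 2 ℤ.* (+ r ℤ.* b·c)) ℤ.+ norm b₀ b₁ b₂ b₃ ℤ.* ∣c∣²
        ≡⟨ cong (ℤ._+_ (+ r ℤ.* + r ℤ.+ + 2 ℤ.* (+ r ℤ.* b·c))) (norm-* b₀ b₁ b₂ b₃ c₀ c₁ c₂ c₃) ⟩
      (+ r ℤ.* + r ℤ.+ + 2 ℤ.* (+ r ℤ.* b·c)) ℤ.+ norm b·c x y z        ≡⟨ shift (+ r) b·c x y z ⟩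
      norm (+ r ℤ.+ b·c) x y z                                          ∎)
    where
    open ≡-Reasoning
    b·c = dot b₀ b₁ b₂ b₃ c₀ c₁ c₂ c₃
    ∣c∣² = norm c₀ c₁ c₂ c₃
    x = cross b₀ b₁ b₂ b₃ c₀ c₁ c₂ c₃
    y = cross b₀ b₂ b₃ b₁ c₀ c₂ c₃ c₁
    z = cross b₀ b₃ b₁ b₂ c₀ c₃ c₁ c₂
    regroup : ∀ r s m n → (r ℤ.+ (+ 2 ℤ.* s ℤ.+ m ℤ.* n)) ℤ.* r ≡ (r ℤ.* r ℤ.+ + 2 ℤ.* (r ℤ.* s)) ℤ.+ m ℤ.* r ℤ.* n
    regroup = ℤ.solve-∀
    shift : ∀ r s x y z → (r ℤ.* r ℤ.+ + 2 ℤ.* (r ℤ.* s)) ℤ.+ (s ℤ.* s ℤ.+ x ℤ.* x ℤ.+ y ℤ.* y ℤ.+ z ℤ.* z)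
                        ≡ (r ℤ.+ s) ℤ.* (r ℤ.+ s) ℤ.+ x ℤ.* x ℤ.+ y ℤ.* y ℤ.+ z ℤ.* z
    shift = ℤ.solve-∀

  -- With a = b + mc, where b is the vector of balanced residues of a, and |b|² = rm, the equation
  -- pm = |a|² becomes p = r + 2b·c + m|c|², and hence pr = (r + b·c)² + |b|²|c|² − (b·c)².
  descent : ∀ {p m} → Prime p → 1 < m → m < p → IsNorm (p * m) → ∃[ r ] 0 < r × r < m × IsNorm (p * r)
  descent {p} {m} p-prime 1<m m<p (a₀ , a₁ , a₂ , a₃ , pm≡)
    with balancedResidue a₀ m {{>-nonZero (<⇒≤ 1<m)}} | balancedResidue a₁ m {{>-nonZero (<⇒≤ 1<m)}}
       | balancedResidue a₂ m {{>-nonZero (<⇒≤ 1<m)}} | balancedResidue a₃ m {{>-nonZero (<⇒≤ 1<m)}}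
  ... | b₀ , c₀ , refl , b₀≤ | b₁ , c₁ , refl , b₁≤ | b₂ , c₂ , refl , b₂≤ | b₃ , c₃ , refl , b₃≤ =
    r , n≢0⇒n>0 r≢0 , ≤∧≢⇒< r≤m r≢m , isNorm-shift {m = m} b₀ b₁ b₂ b₃ c₀ c₁ c₂ c₃ p≡ ∣b∣²≡mr
    where
    instance
      m-nonZero : NonZero m
      m-nonZero = >-nonZero (<⇒≤ 1<m)
    b·c = dot b₀ b₁ b₂ b₃ c₀ c₁ c₂ c₃
    ∣b∣² = norm b₀ b₁ b₂ b₃
    ∣c∣² = norm c₀ c₁ c₂ c₃
    N = abs b₀ * abs b₀ + abs b₁ * abs b₁ + abs b₂ * abs b₂ + abs b₃ * abs b₃
    ∣b∣²≡N : ∣b∣² ≡ + N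
    ∣b∣²≡N = norm≡+Σ∣∣² b₀ b₁ b₂ b₃

    mp≡ : + m ℤ.* + p ≡ ∣b∣² ℤ.+ + m ℤ.* (+ 2 ℤ.* b·c ℤ.+ + m ℤ.* ∣c∣²)
    mp≡ = trans (trans (sym (ℤ.pos-* m p)) (cong +_ (*-comm m p)))
            (trans pm≡ (norm-+* (+ m) b₀ b₁ b₂ b₃ c₀ c₁ c₂ c₃))

    m∣N : m ∣ N
    m∣N = ℤ.∣⇒∣ᵤ {+ m} {+ N} (subst (+ m ℤ.∣_) ∣b∣²≡N
            (ℤ.∣m+n∣n⇒∣m (subst (+ m ℤ.∣_) mp≡ (ℤ.∣m⇒∣m*n (+ p) ℤ.∣-refl))
              (ℤ.∣m⇒∣m*n (+ 2 ℤ.* b·c ℤ.+ + m ℤ.* ∣c∣²) ℤ.∣-refl)))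

    r = quotient m∣N

    N≡rm : N ≡ r * m
    N≡rm = _∣_.equality m∣N

    ∣b∣²≡mr : ∣b∣² ≡ + m ℤ.* + r
    ∣b∣²≡mr = trans ∣b∣²≡N (trans (cong +_ (trans N≡rm (*-comm r m))) (ℤ.pos-* m r))

    p≡ : + p ≡ + r ℤ.+ (+ 2 ℤ.* b·c ℤ.+ + m ℤ.* ∣c∣²)
    p≡ = ℤ.*-cancelˡ-≡ (+ m) _ _ (trans mp≡ (trans (cong (ℤ._+ + m ℤ.* (+ 2 ℤ.* b·c ℤ.+ + m ℤ.* ∣c∣²)) ∣b∣²≡mr)
           (sym (ℤ.*-distribˡ-+ (+ m) (+ r) (+ 2 ℤ.* b·c ℤ.+ + m ℤ.* ∣c∣²)))))

    4N≡ : 2 * abs b₀ * (2 * abs b₀) +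
          (2 * abs b₁ * (2 * abs b₁) + 2 * abs b₂ * (2 * abs b₂) + 2 * abs b₃ * (2 * abs b₃))
          ≡ 4 * N
    4N≡ = identity (abs b₀) (abs b₁) (abs b₂) (abs b₃)
      where
      identity : ∀ x y z w → 2 * x * (2 * x) + (2 * y * (2 * y) + 2 * z * (2 * z) + 2 * w * (2 * w))
                           ≡ 4 * (x * x + y * y + z * z + w * w)
      identity = solve-∀

    4m² : ∀ m → m * m + (m * m + m * m + m * m) ≡ 4 * (m * m)
    4m² = solve-∀

    -- Since N = rm and 4N = Σ (2|bᵢ|)² ≤ 4m²; the factor 4 avoids halving m.
    r≤m : r ≤ m
    r≤m = *-cancelʳ-≤ r m m (*-cancelˡ-≤ 4 (begin
      4 * (r * m) ≡⟨ cong (4 *_) N≡rm ⟨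
      4 * N       ≡⟨ 4N≡ ⟨
      _           ≤⟨ +-mono-≤ (*-mono-≤ b₀≤ b₀≤)
                      (+-mono-≤ (+-mono-≤ (*-mono-≤ b₁≤ b₁≤) (*-mono-≤ b₂≤ b₂≤)) (*-mono-≤ b₃≤ b₃≤)) ⟩
      _           ≡⟨ 4m² m ⟩
      4 * (m * m) ∎))
      where open ≤-Reasoning

    m∤p : ¬ m ∣ p
    m∤p m∣p with prime⇒irreducible p-prime m∣p
    ... | inj₁ refl = n≮n 1 1<m
    ... | inj₂ refl = n≮n p m<p

    m∣2b·c : (∀ c → + m ℤ.∣ + 2 ℤ.* b₀ ℤ.* c) → (∀ c → + m ℤ.∣ + 2 ℤ.* b₁ ℤ.* c) →
             (∀ c → + m ℤ.∣ + 2 ℤ.* b₂ ℤ.* c) → (∀ c → + m ℤ.∣ + 2 ℤ.* b₃ ℤ.* c) → + m ℤ.∣ + 2 ℤ.* b·c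
    m∣2b·c d₀ d₁ d₂ d₃ = subst (+ m ℤ.∣_) (identity b₀ b₁ b₂ b₃ c₀ c₁ c₂ c₃)
      (ℤ.∣m∣n⇒∣m+n (ℤ.∣m∣n⇒∣m+n (ℤ.∣m∣n⇒∣m+n (d₀ c₀) (d₁ c₁)) (d₂ c₂)) (d₃ c₃))
      where
      identity : ∀ b₀ b₁ b₂ b₃ c₀ c₁ c₂ c₃ →
        + 2 ℤ.* b₀ ℤ.* c₀ ℤ.+ + 2 ℤ.* b₁ ℤ.* c₁ ℤ.+ + 2 ℤ.* b₂ ℤ.* c₂ ℤ.+ + 2 ℤ.* b₃ ℤ.* c₃ ≡
        + 2 ℤ.* (b₀ ℤ.* c₀ ℤ.+ b₁ ℤ.* c₁ ℤ.+ b₂ ℤ.* c₂ ℤ.+ b₃ ℤ.* c₃)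
      identity = ℤ.solve-∀

    -- Both extremes contradict 1 < m < p in this way: if r = 0, all bᵢ vanish; if r = m, all 2|bᵢ|
    -- equal m. Either way m divides every term of p = r + 2b·c + m|c|².
    m∣p : m ∣ r → m ∣ 2 * abs b₀ → m ∣ 2 * abs b₁ → m ∣ 2 * abs b₂ → m ∣ 2 * abs b₃ → m ∣ p
    m∣p m∣r d₀ d₁ d₂ d₃ = ℤ.∣⇒∣ᵤ {+ m} {+ p} (subst (+ m ℤ.∣_) (sym p≡)
      (ℤ.∣m∣n⇒∣m+n (ℤ.∣ᵤ⇒∣ {+ m} {+ r} m∣r)
        (ℤ.∣m∣n⇒∣m+n
          (m∣2b·c (λ c → ℤ.∣m⇒∣m*n c (m∣2∣b∣⇒m∣2b b₀ d₀)) (λ c → ℤ.∣m⇒∣m*n c (m∣2∣b∣⇒m∣2b b₁ d₁))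
                  (λ c → ℤ.∣m⇒∣m*n c (m∣2∣b∣⇒m∣2b b₂ d₂)) (λ c → ℤ.∣m⇒∣m*n c (m∣2∣b∣⇒m∣2b b₃ d₃)))
          (ℤ.∣m⇒∣m*n ∣c∣² ℤ.∣-refl))))

    r≢m : r ≢ m
    r≢m r≡m = m∤p (m∣p (∣-reflexive (sym r≡m))
      (∣-reflexive (sym (≤∧Σ²≡4m²⇒≡m b₀≤ b₁≤ b₂≤ b₃≤ Σ≡)))
      (∣-reflexive (sym (≤∧Σ²≡4m²⇒≡m b₁≤ b₀≤ b₂≤ b₃≤ (trans (rotate₁ (sq b₀) (sq b₁) (sq b₂) (sq b₃)) Σ≡))))
      (∣-reflexive (sym (≤∧Σ²≡4m²⇒≡m b₂≤ b₀≤ b₁≤ b₃≤ (trans (rotate₂ (sq b₀) (sq b₁) (sq b₂) (sq b₃)) Σ≡))))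
      (∣-reflexive (sym (≤∧Σ²≡4m²⇒≡m b₃≤ b₀≤ b₁≤ b₂≤ (trans (rotate₃ (sq b₀) (sq b₁) (sq b₂) (sq b₃)) Σ≡)))))
      where
      sq : ℤ → ℕ
      sq b = 2 * abs b * (2 * abs b)
      Σ≡ : sq b₀ + (sq b₁ + sq b₂ + sq b₃) ≡ m * m + (m * m + m * m + m * m)
      Σ≡ = trans 4N≡ (trans (cong (4 *_) (trans N≡rm (cong (_* m) r≡m))) (sym (4m² m)))
      rotate₁ : ∀ x y z w → y + (x + z + w) ≡ x + (y + z + w)
      rotate₁ = solve-∀
      rotate₂ : ∀ x y z w → z + (x + y + w) ≡ x + (y + z + w)
      rotate₂ = solve-∀
      rotate₃ : ∀ x y z w → w + (x + y + z) ≡ x + (y + z + w)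
      rotate₃ = solve-∀

    r≢0 : r ≢ 0
    r≢0 r≡0 = m∤p (m∣p (subst (m ∣_) (sym r≡0) (m ∣0))
      (m∣2∙ (abs b₀) (m+n≡0⇒m≡0 _ Σ₂≡0)) (m∣2∙ (abs b₁) (m+n≡0⇒n≡0 (abs b₀ * abs b₀) Σ₂≡0))
      (m∣2∙ (abs b₂) (m+n≡0⇒n≡0 (abs b₀ * abs b₀ + abs b₁ * abs b₁) Σ₃≡0))
      (m∣2∙ (abs b₃) (m+n≡0⇒n≡0 (abs b₀ * abs b₀ + abs b₁ * abs b₁ + abs b₂ * abs b₂) N≡0)))
      where
      N≡0 : N ≡ 0
      N≡0 = trans N≡rm (cong (_* m) r≡0)
      Σ₃≡0 = m+n≡0⇒m≡0 (abs b₀ * abs b₀ + abs b₁ * abs b₁ + abs b₂ * abs b₂) N≡0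
      Σ₂≡0 = m+n≡0⇒m≡0 (abs b₀ * abs b₀ + abs b₁ * abs b₁) Σ₃≡0
      m∣2∙ : ∀ x → x * x ≡ 0 → m ∣ 2 * x
      m∣2∙ zero _ = m ∣0

  even⊎odd : ∀ n → ∃[ h ] (n ≡ h + h ⊎ n ≡ suc (h + h))
  even⊎odd zero = 0 , inj₁ refl
  even⊎odd (suc n) with even⊎odd n
  ... | h , inj₁ refl = h , inj₂ refl
  ... | h , inj₂ refl = suc h , inj₁ (cong suc (sym (+-suc h h)))

  2∣h+h : ∀ h → 2 ∣ h + h
  2∣h+h h = divides h (identity h)
    where
    identity : ∀ h → h + h ≡ h * 2
    identity = solve-∀

  oddPrime : ∀ {p} → Prime p → p ≢ 2 → ∃[ h ] p ≡ suc (h + h)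
  oddPrime {p} p-prime p≢2 with even⊎odd p
  ... | h , inj₂ p≡1+2h = h , p≡1+2h
  ... | h , inj₁ refl with prime⇒irreducible p-prime (2∣h+h h)
  ...   | inj₂ 2≡p = contradiction (sym 2≡p) p≢2

  -- With p = 2h + 1 and x, y ≤ h, the multiple is at most 2h² + 1 < p², so m < p. This starts the
  -- descent, and for k = 3 it also supplies multiples of p that are sums of three squares.
  x²+y²+1≡mp : ∀ {p} → Prime p → p ≢ 2 →
               ∃₂ λ x y → ∃[ m ] x * x + y * y + 1 ≡ m * p × 0 < m × m < p
  x²+y²+1≡mp {p} p-prime p≢2 with oddPrime p-prime p≢2
  ... | h , refl with p∣x²+y²+1 {h = h} p-prime refl
  ...   | x , y , x≤h , y≤h , divides m eq = x , y , m , eq , m>0 m eq , *-cancelʳ-< p m p mp<p²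
    where
    m>0 : ∀ m → x * x + y * y + 1 ≡ m * p → 0 < m
    m>0 zero    eq = contradiction (trans (+-comm 1 (x * x + y * y)) eq) λ ()
    m>0 (suc m) _  = z<s
    identity : ∀ h → h * h + h * h + 1 + (4 * h + 2 * (h * h)) ≡ suc (h + h) * suc (h + h)
    identity = solve-∀
    h>0 : ∀ h → Prime (suc (h + h)) → 0 < h
    h>0 zero    p-prime = contradiction p-prime ¬prime[1]
    h>0 (suc h) _       = z<s
    mp<p² : m * p < p * p
    mp<p² = begin-strict
      m * p               ≡⟨ eq ⟨
      x * x + y * y + 1   ≤⟨ +-monoˡ-≤ 1 (+-mono-≤ (*-mono-≤ x≤h x≤h) (*-mono-≤ y≤h y≤h)) ⟩
      h * h + h * h + 1   <⟨ m<m+n (h * h + h * h + 1)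
        (≤-trans (≤-trans (h>0 h p-prime) (m≤n*m h 4)) (m≤m+n (4 * h) (2 * (h * h)))) ⟩
      h * h + h * h + 1 + (4 * h + 2 * (h * h)) ≡⟨ identity h ⟩
      p * p               ∎
      where open ≤-Reasoning

  isNorm-prime : ∀ {p} → Prime p → IsNorm p
  isNorm-prime {p} p-prime with p ≟ 2
  ... | yes refl = 1ℤ , 1ℤ , 0ℤ , 0ℤ , refl
  ... | no  p≢2 with x²+y²+1≡mp p-prime p≢2
  ...   | x , y , m , eq , 0<m , m<p = descend m 0<m m<p (+ x , + y , 1ℤ , 0ℤ , (begin
    + (p * m)                           ≡⟨ cong +_ (trans (*-comm p m) (sym eq)) ⟩
    + (x * x + y * y + 1)               ≡⟨ cong₂ (λ u v → u ℤ.+ v ℤ.+ 1ℤ) (ℤ.pos-* x x) (ℤ.pos-* y y) ⟩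
    + x ℤ.* + x ℤ.+ + y ℤ.* + y ℤ.+ 1ℤ  ≡⟨ ℤ.+-identityʳ _ ⟨
    norm (+ x) (+ y) 1ℤ 0ℤ              ∎))
    where
    open ≡-Reasoning
    descend : ∀ m → 0 < m → m < p → IsNorm (p * m) → IsNorm p
    descend = <-rec _ step
      where
      step : ∀ m → (∀ {r} → r < m → 0 < r → r < p → IsNorm (p * r) → IsNorm p) →
             0 < m → m < p → IsNorm (p * m) → IsNorm p
      step m rec 0<m m<p pm with m ≟ 1
      ... | yes refl = subst IsNorm (*-identityʳ p) pm
      ... | no  m≢1 with descent p-prime (≤∧≢⇒< 0<m (m≢1 ∘ sym)) m<p pm
      ...   | r , 0<r , r<m , pr = rec r<m 0<r (<-trans r<m m<p) pr

  isNorm-* : ∀ {m n} → IsNorm m → IsNorm n → IsNorm (m * n)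
  isNorm-* {m} {n} (a , b , c , d , m≡) (x , y , z , w , n≡) =
    dot a b c d x y z w , cross a b c d x y z w , cross a c d b x z w y , cross a d b c x w y z ,
    trans (ℤ.pos-* m n) (trans (cong₂ ℤ._*_ m≡ n≡) (norm-* a b c d x y z w))

  isNorm : ∀ n .{{_ : NonZero n}} → IsNorm n
  isNorm n = subst IsNorm (sym (PrimeFactorisation.isFactorisation n-factored))
                   (isNorm-product (PrimeFactorisation.factorsPrime n-factored))
    where
    n-factored = factorise n
    isNorm-product : ∀ {ps} → All Prime ps → IsNorm (product ps)
    isNorm-product []       = 1ℤ , 0ℤ , 0ℤ , 0ℤ , refl
    isNorm-product (p ∷ ps) = isNorm-* (isNorm-prime p) (isNorm-product ps)

  -- Sums of exactly k positive squares

  Σ² : ∀ {k} → Vec ℕ⁺ k → ℕ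
  Σ² xs = sumℕ (λ i → value (lookup xs i) ^ 2)

  IsSumOfSquares : ℕ → ℕ → Set
  IsSumOfSquares k n = ∃[ xs ] Σ² {k} xs ≡ n

  Σ²-++ : ∀ {j k} (xs : Vec ℕ⁺ j) (ys : Vec ℕ⁺ k) → Σ² (xs ++ ys) ≡ Σ² xs + Σ² ys
  Σ²-++ []       ys = refl
  Σ²-++ (x ∷ xs) ys = trans (cong (_+_ (value x ^ 2)) (Σ²-++ xs ys)) (sym (+-assoc (value x ^ 2) (Σ² xs) (Σ² ys)))

  Σ²-replicate : ∀ k x → Σ² (replicate k x) ≡ k * value x ^ 2
  Σ²-replicate zero    x = refl
  Σ²-replicate (suc k) x = cong (_+_ (value x ^ 2)) (Σ²-replicate k x)

  isSumOfSquares-+ : ∀ {j k m n} → IsSumOfSquares j m → IsSumOfSquares k n → IsSumOfSquares (j + k) (m + n)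
  isSumOfSquares-+ (xs , refl) (ys , refl) = xs ++ ys , Σ²-++ xs ys

  isSumOfSquares-ones : ∀ k → IsSumOfSquares k k
  isSumOfSquares-ones k = replicate k 1⁺ , trans (Σ²-replicate k 1⁺) (*-identityʳ k)

  Σ²₃ : ∀ x y z .{{_ : NonZero x}} .{{_ : NonZero y}} .{{_ : NonZero z}} →
        IsSumOfSquares 3 (x * x + y * y + z * z)
  Σ²₃ x y z = mk⁺ x ∷ mk⁺ y ∷ mk⁺ z ∷ [] , identity x y z
    where
    identity : ∀ x y z → x * (x * 1) + (y * (y * 1) + (z * (z * 1) + 0)) ≡ x * x + y * y + z * z
    identity = solve-∀

  Σ²₄ : ∀ x y z w .{{_ : NonZero x}} .{{_ : NonZero y}} .{{_ : NonZero z}} .{{_ : NonZero w}} →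
        IsSumOfSquares 4 (x * x + y * y + z * z + w * w)
  Σ²₄ x y z w = mk⁺ x ∷ mk⁺ y ∷ mk⁺ z ∷ mk⁺ w ∷ [] , identity x y z w
    where
    identity : ∀ x y z w → x * (x * 1) + (y * (y * 1) + (z * (z * 1) + (w * (w * 1) + 0))) ≡
                           x * x + y * y + z * z + w * w
    identity = solve-∀

  square-isSumOfSquares : ∀ a → ∃[ j ] j ≤ 1 × IsSumOfSquares j (a * a)
  square-isSumOfSquares zero    = 0 , z≤n , [] , refl
  square-isSumOfSquares (suc a) = 1 , ≤-refl , mk⁺ (suc a) ∷ [] , identity (suc a)
    where
    identity : ∀ x → x * (x * 1) + 0 ≡ x * x
    identity = solve-∀

  sumOfFourSquares : ∀ n .{{_ : NonZero n}} → ∃₂ λ a b → ∃₂ λ c d → n ≡ a * a + b * b + c * c + d * d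
  sumOfFourSquares n with isNorm n
  ... | a , b , c , d , n≡ = abs a , abs b , abs c , abs d , ℤ.+-injective (trans n≡ (norm≡+Σ∣∣² a b c d))

  sumOfAtMostFourSquares : ∀ n .{{_ : NonZero n}} → ∃[ j ] j ≤ 4 × IsSumOfSquares j n
  sumOfAtMostFourSquares n with sumOfFourSquares n
  ... | a , b , c , d , refl
    with square-isSumOfSquares a | square-isSumOfSquares b | square-isSumOfSquares c | square-isSumOfSquares d
  ... | i , i≤1 , P | j , j≤1 , Q | k , k≤1 , R | l , l≤1 , S =
    i + j + k + l , +-mono-≤ (+-mono-≤ (+-mono-≤ i≤1 j≤1) k≤1) l≤1 ,
    isSumOfSquares-+ (isSumOfSquares-+ (isSumOfSquares-+ P Q) R) S

  -- 169 is a sum of j positive squares for every j from 1 to 5, so it fills up the missing terms of n.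
  169+n-isSumOfFiveSquares : ∀ n .{{_ : NonZero n}} → IsSumOfSquares 5 (169 + n)
  169+n-isSumOfFiveSquares n with sumOfAtMostFourSquares n
  ... | 0 , _ , P = isSumOfSquares-+ (mk⁺ 12 ∷ mk⁺ 4 ∷ mk⁺ 2 ∷ mk⁺ 2 ∷ 1⁺ ∷ [] , refl) P
  ... | 1 , _ , P = isSumOfSquares-+ (mk⁺ 10 ∷ mk⁺ 8 ∷ mk⁺ 2 ∷ 1⁺ ∷ [] , refl) P
  ... | 2 , _ , P = isSumOfSquares-+ (mk⁺ 12 ∷ mk⁺ 4 ∷ mk⁺ 3 ∷ [] , refl) P
  ... | 3 , _ , P = isSumOfSquares-+ (mk⁺ 12 ∷ mk⁺ 5 ∷ [] , refl) P
  ... | 4 , _ , P = isSumOfSquares-+ (mk⁺ 13 ∷ [] , refl) P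
  ... | suc (suc (suc (suc (suc _)))) , s≤s (s≤s (s≤s (s≤s ()))) , _

  -- Write n = (169 + d) + r with d > 0: five squares take care of 169 + d, and r ones of the rest.
  isSumOfSquares-large : ∀ r n → 169 + r < n → IsSumOfSquares (5 + r) n
  isSumOfSquares-large r n 169+r<n = subst (IsSumOfSquares (5 + r)) eq
    (isSumOfSquares-+ (169+n-isSumOfFiveSquares d {{>-nonZero (m<n⇒0<n∸m 169+r<n)}}) (isSumOfSquares-ones r))
    where
    d = n ∸ (169 + r)
    rearrange : ∀ c d r → c + d + r ≡ c + r + d
    rearrange = solve-∀
    eq : 169 + d + r ≡ n
    eq = trans (rearrange 169 d r) (m+[n∸m]≡n (<⇒≤ 169+r<n))

  coprime-1+* : ∀ n q → Coprime n (1 + n * q)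
  coprime-1+* n q {d} (d∣n , d∣1+nq) =
    ∣1⇒≡1 (∣m+n∣m⇒∣n (subst (d ∣_) (+-comm 1 (n * q)) d∣1+nq) (∣m⇒∣m*n q d∣n))

  positiveDifference : ∀ {m n} → n < m → ∃[ u ] NonZero u × + m ℤ.- + n ≡ + u
  positiveDifference {m} {n} n<m = m ∸ n , >-nonZero (m<n⇒0<n∸m n<m) ,
    trans (ℤ.m-n≡m⊖n m n) (ℤ.⊖-≥ (<⇒≤ n<m))

  -- If n = a² + b² + c² is the norm of a quaternion β, then the norm of β times 1 + ni + n²j + nk
  -- is a sum of four positive squares.
  multiple-isSumOfFourSquares : ∀ {n} a b c .{{_ : NonZero a}} .{{_ : NonZero b}} →
    n ≡ a * a + b * b + c * c →
    ∃[ q ] IsSumOfSquares 4 (1 + n * q) × IsSumOfSquares 4 (n * (1 + n * q))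
  multiple-isSumOfFourSquares {n} a b c n≡ = q , 1+nq-isSum , n[1+nq]-isSum
    where
    -- Chosen so that 1 + nq = 1² + n² + (n²)² + n², the norm of the multiplier.
    q = n + n * (n * n) + n

    1≤a*a : 1 ≤ a * a
    1≤a*a = *-mono-≤ (>-nonZero⁻¹ a) (>-nonZero⁻¹ a)
    x≤x*x : ∀ x → x ≤ x * x
    x≤x*x zero      = z≤n
    x≤x*x x@(suc _) = m≤m*n x x

    b<n : b < n
    b<n = subst (b <_) (sym n≡) (≤-trans (+-mono-≤ 1≤a*a (x≤x*x b)) (m≤m+n (a * a + b * b) (c * c)))
    c<n : c < n
    c<n = subst (c <_) (sym n≡) (+-mono-≤ (≤-trans 1≤a*a (m≤m+n (a * a) (b * b))) (x≤x*x c))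

    instance
      n-nonZero : NonZero n
      n-nonZero = >-nonZero (≤-<-trans z≤n c<n)
      n*n-nonZero : NonZero (n * n)
      n*n-nonZero = m*n≢0 n n
      r-nonZero : NonZero (a + b * n + c * (n * n))
      r-nonZero = >-nonZero (≤-trans (>-nonZero⁻¹ a) (≤-trans (m≤m+n a (b * n)) (m≤m+n (a + b * n) (c * (n * n)))))

    -- These three inequalities make the imaginary coordinates of the product positive. They rest on
    -- b, c < n and a, b > 0; c may be 0.
    b<an+cn : b < a * n + c * n
    b<an+cn = <-≤-trans b<n (≤-trans (m≤n*m n a) (m≤m+n (a * n) (c * n)))
    c+bn<an² : c + b * n < a * (n * n)
    c+bn<an² = <-≤-trans (+-monoˡ-< (b * n) c<n) (≤-trans (*-monoˡ-≤ n b<n) (m≤n*m (n * n) a))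
    cn<an+bn² : c * n < a * n + b * (n * n)
    cn<an+bn² = <-≤-trans (*-monoˡ-< n c<n) (≤-trans (m≤n*m (n * n) b) (m≤n+m (b * (n * n)) (a * n)))

    1+nq≡1+n²+n⁴+n² : ∀ n → 1 + n * n + n * n * (n * n) + n * n ≡ 1 + n * (n + n * (n * n) + n)
    1+nq≡1+n²+n⁴+n² = solve-∀

    1+nq-isSum : IsSumOfSquares 4 (1 + n * q)
    1+nq-isSum = subst (IsSumOfSquares 4) (1+nq≡1+n²+n⁴+n² n) (Σ²₄ 1 n (n * n) n)

    A = + a
    B = + b
    C = + c
    N = + n

    n[1+nq]-isSum : IsSumOfSquares 4 (n * (1 + n * q))
    n[1+nq]-isSum with positiveDifference b<an+cn | positiveDifference c+bn<an² | positiveDifference cn<an+bn²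
    ... | u , u≢0 , u≡ | v , v≢0 , v≡ | w , w≢0 , w≡ =
      subst (IsSumOfSquares 4) (sym (ℤ.+-injective n[1+nq]≡)) (Σ²₄ r u v w {{r-nonZero}} {{u≢0}} {{v≢0}} {{w≢0}})
      where
      open ≡-Reasoning
      r = a + b * n + c * (n * n)
      pos-n*n : ∀ x → + (x * (n * n)) ≡ + x ℤ.* (N ℤ.* N)
      pos-n*n x = trans (ℤ.pos-* x (n * n)) (cong (ℤ._*_ (+ x)) (ℤ.pos-* n n))
      N≡ : N ≡ norm A B C 0ℤ
      N≡ = trans (cong +_ n≡) (trans
        (cong₂ ℤ._+_ (cong₂ ℤ._+_ (ℤ.pos-* a a) (ℤ.pos-* b b)) (ℤ.pos-* c c))
        (sym (ℤ.+-identityʳ (A ℤ.* A ℤ.+ B ℤ.* B ℤ.+ C ℤ.* C))))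
      1+nq≡ : + (1 + n * q) ≡ norm 1ℤ N (N ℤ.* N) N
      1+nq≡ = trans (cong +_ (sym (1+nq≡1+n²+n⁴+n² n)))
        (trans (sym (norm≡+Σ∣∣² 1ℤ N (+ (n * n)) N)) (cong (λ x → norm 1ℤ N x N) (ℤ.pos-* n n)))
      dot≡ : ∀ a b c n → a ℤ.* 1ℤ ℤ.+ b ℤ.* n ℤ.+ c ℤ.* (n ℤ.* n) ℤ.+ 0ℤ ℤ.* n ≡
                       a ℤ.+ b ℤ.* n ℤ.+ c ℤ.* (n ℤ.* n)
      dot≡ = ℤ.solve-∀
      cross₁≡ : ∀ a b c n → a ℤ.* n ℤ.- b ℤ.* 1ℤ ℤ.+ c ℤ.* n ℤ.- 0ℤ ℤ.* (n ℤ.* n) ≡ (a ℤ.* n ℤ.+ c ℤ.* n) ℤ.- b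
      cross₁≡ = ℤ.solve-∀
      cross₂≡ : ∀ a b c n → a ℤ.* (n ℤ.* n) ℤ.- c ℤ.* 1ℤ ℤ.+ 0ℤ ℤ.* n ℤ.- b ℤ.* n ≡
                          a ℤ.* (n ℤ.* n) ℤ.- (c ℤ.+ b ℤ.* n)
      cross₂≡ = ℤ.solve-∀
      cross₃≡ : ∀ a b c n → a ℤ.* n ℤ.- 0ℤ ℤ.* 1ℤ ℤ.+ b ℤ.* (n ℤ.* n) ℤ.- c ℤ.* n ≡
                          (a ℤ.* n ℤ.+ b ℤ.* (n ℤ.* n)) ℤ.- c ℤ.* n
      cross₃≡ = ℤ.solve-∀
      n[1+nq]≡ : + (n * (1 + n * q)) ≡ + (r * r + u * u + v * v + w * w)
      n[1+nq]≡ = begin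
        + (n * (1 + n * q))                          ≡⟨ ℤ.pos-* n (1 + n * q) ⟩
        N ℤ.* + (1 + n * q)                          ≡⟨ cong₂ ℤ._*_ N≡ 1+nq≡ ⟩
        norm A B C 0ℤ ℤ.* norm 1ℤ N (N ℤ.* N) N      ≡⟨ norm-* A B C 0ℤ 1ℤ N (N ℤ.* N) N ⟩
        norm (dot A B C 0ℤ 1ℤ N (N ℤ.* N) N) (cross A B C 0ℤ 1ℤ N (N ℤ.* N) N)
             (cross A C 0ℤ B 1ℤ (N ℤ.* N) N N) (cross A 0ℤ B C 1ℤ N N (N ℤ.* N))
          ≡⟨ norm-cong
               (trans (dot≡ A B C N) (sym (cong₂ ℤ._+_ (cong (ℤ._+_ A) (ℤ.pos-* b n)) (pos-n*n c))))
               (trans (cross₁≡ A B C N)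
                 (trans (sym (cong (ℤ._- B) (cong₂ ℤ._+_ (ℤ.pos-* a n) (ℤ.pos-* c n)))) u≡))
               (trans (cross₂≡ A B C N)
                 (trans (sym (cong₂ ℤ._-_ (pos-n*n a) (cong (ℤ._+_ C) (ℤ.pos-* b n)))) v≡))
               (trans (cross₃≡ A B C N)
                 (trans (sym (cong₂ ℤ._-_ (cong₂ ℤ._+_ (ℤ.pos-* a n) (pos-n*n b)) (ℤ.pos-* c n))) w≡)) ⟩
        norm (+ r) (+ u) (+ v) (+ w)                 ≡⟨ norm≡+Σ∣∣² (+ r) (+ u) (+ v) (+ w) ⟩
        + (r * r + u * u + v * v + w * w)            ∎
        where
        norm-cong : ∀ {x x′ y y′ z z′ w w′} → x ≡ x′ → y ≡ y′ → z ≡ z′ → w ≡ w′ → norm x y z w ≡ norm x′ y′ z′ w′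
        norm-cong refl refl refl refl = refl

  Σ²-scale : ∀ {k} t .{{_ : NonZero t}} (xs : Vec ℕ⁺ k) → Σ² (map (mk⁺ t *⁺_) xs) ≡ t * t * Σ² xs
  Σ²-scale t []       = sym (*-zeroʳ (t * t))
  Σ²-scale t (x ∷ xs) = trans (cong (_+_ ((t * value x) ^ 2)) (Σ²-scale t xs)) (identity t (value x) (Σ² xs))
    where
    identity : ∀ t x s → t * x * (t * x * 1) + t * t * s ≡ t * t * (x * (x * 1) + s)
    identity = solve-∀

  isSumOfSquares-scale : ∀ {k n} t .{{_ : NonZero t}} → IsSumOfSquares k n → IsSumOfSquares k (t * t * n)
  isSumOfSquares-scale t (xs , refl) = map (mk⁺ t *⁺_) xs , Σ²-scale t xs

  -- Coprimality and prime valuations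

  coprime-* : ∀ {m n o} → Coprime m o → Coprime n o → Coprime (m * n) o
  coprime-* m⊥o n⊥o {d} (d∣mn , d∣o) =
    n⊥o (Coprime.coprime-divisor (λ (c∣d , c∣m) → m⊥o (c∣m , ∣-trans c∣d d∣o)) d∣mn , d∣o)

  coprime-^ : ∀ {m n} e → Coprime m n → Coprime (m ^ e) n
  coprime-^ {m} {n} zero    m⊥n = Coprime.1-coprimeTo n
  coprime-^ {m} {n} (suc e) m⊥n = coprime-* m⊥n (coprime-^ e m⊥n)

  ∤⇒coprime : ∀ {p n} → Prime p → ¬ p ∣ n → Coprime p n
  ∤⇒coprime p-prime p∤n (d∣p , d∣n) with prime⇒irreducible p-prime d∣p
  ... | inj₁ d≡1  = d≡1
  ... | inj₂ refl = contradiction d∣n p∤n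

  valuation : ∀ {p} → Prime p → ∀ n .{{_ : NonZero n}} → ∃₂ λ e q → n ≡ p ^ e * q × Coprime p q
  valuation {p} p-prime n = <-rec (λ n → 0 < n → ∃₂ λ e q → n ≡ p ^ e * q × Coprime p q) step n (>-nonZero⁻¹ n)
    where
    step : ∀ n → (∀ {m} → m < n → 0 < m → ∃₂ λ e q → m ≡ p ^ e * q × Coprime p q) →
           0 < n → ∃₂ λ e q → n ≡ p ^ e * q × Coprime p q
    step n rec n>0 with p ∣? n
    ... | no p∤n = 0 , n , sym (*-identityˡ n) , ∤⇒coprime p-prime p∤n
    ... | yes (divides m n≡mp) with rec m<n m>0
      where
      m≢0 : NonZero m
      m≢0 = m*n≢0⇒m≢0 m {p} {{>-nonZero (subst (0 <_) n≡mp n>0)}}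
      m>0 : 0 < m
      m>0 = >-nonZero⁻¹ m {{m≢0}}
      m<n : m < n
      m<n = subst (m <_) (sym n≡mp) (m<m*n m p {{m≢0}} (nonTrivial⇒n>1 p {{prime⇒nonTrivial p-prime}}))
    ...   | e , q , m≡ , p⊥q = suc e , q , trans n≡mp (trans (cong (_* p) m≡) (rearrange (p ^ e) q p)) , p⊥q
      where
      rearrange : ∀ x q p → x * q * p ≡ p * x * q
      rearrange = solve-∀

  primeDivisor : ∀ {n} → 1 < n → ∃[ p ] Prime p × p ∣ n
  primeDivisor {n} 1<n = go (PrimeFactorisation.factors n-factored)
    (PrimeFactorisation.isFactorisation n-factored) (PrimeFactorisation.factorsPrime n-factored)
    where
    n-factored = factorise n {{>-nonZero (<⇒≤ 1<n)}}
    go : ∀ ps → n ≡ product ps → All Prime ps → ∃[ p ] Prime p × p ∣ n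
    go []       n≡1 _             = contradiction (sym n≡1) (<⇒≢ 1<n)
    go (p ∷ ps) n≡  (p-prime ∷ _) = p , p-prime , subst (p ∣_) (sym n≡) (m∣m*n (product ps))

  -- The properties of the set S of all n with f(n) = n.
  record IsClosed {ℓ} (k : ℕ) (S : ℕ → Set ℓ) : Set ℓ where
    field
      sum∈     : ∀ {n} → IsSumOfSquares k n → S n
      *-closed : ∀ m n .{{_ : NonZero m}} .{{_ : NonZero n}} → Coprime m n → S m → S n → S (m * n)
      cancel   : ∀ m n .{{_ : NonZero m}} .{{_ : NonZero n}} → Coprime n m → S m → S (n * m) → S n

  -- Closed sets contain every positive integer

  module _ {ℓ : Level} {k : ℕ} {S : ℕ → Set ℓ} (closed : IsClosed (suc k) S) where
    open IsClosed closed

    -- The cofactor is 1² + t² + ... + t² with k copies of t². It is coprime to t², and t² times it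
    -- is again a sum of `suc k` positive squares, by scaling.
    square∈ : ∀ t .{{_ : NonZero t}} → S (t * t)
    square∈ t = cancel (1 + t * t * k) (t * t) {{it}} {{m*n≢0 t t}} (coprime-1+* (t * t) k)
      (sum∈ 1+t²k-isSum) (sum∈ (isSumOfSquares-scale t 1+t²k-isSum))
      where
      identity : ∀ t k → 1 + k * (t * (t * 1)) ≡ 1 + t * t * k
      identity = solve-∀
      1+t²k-isSum : IsSumOfSquares (suc k) (1 + t * t * k)
      1+t²k-isSum = 1⁺ ∷ replicate k (mk⁺ t) , trans (cong suc (Σ²-replicate k (mk⁺ t))) (identity t k)

    1∈ : S 1
    1∈ = square∈ 1

  closed-≥5 : ∀ {ℓ} r {S : ℕ → Set ℓ} → IsClosed (5 + r) S → ∀ n .{{_ : NonZero n}} → S n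
  closed-≥5 r closed n = cancel m n (coprime-1+* n (169 + r)) (sum∈ (isSumOfSquares-large r m m-large))
      (sum∈ (isSumOfSquares-large r (n * m) (<-≤-trans m-large (m≤n*m m n))))
    where
    open IsClosed closed
    m = 1 + n * (169 + r)
    m-large : 169 + r < m
    m-large = s≤s (m≤n*m (169 + r) n)

  -- The case distinction is on the number of nonzero squares given by Lagrange. The quaternion
  -- multiplier needs two nonzero coordinates, so it serves for two squares (with c = 0) and for
  -- three; a single square is in S by `square∈`.
  closed-4 : ∀ {ℓ} {S : ℕ → Set ℓ} → IsClosed 4 S → ∀ n .{{_ : NonZero n}} → S n
  closed-4 {S = S} closed n with sumOfAtMostFourSquares n
  ... | j , j≤4 , P = cases j j≤4 P
    where
    open IsClosed closed
    cancelMultiple : ∃[ q ] IsSumOfSquares 4 (1 + n * q) × IsSumOfSquares 4 (n * (1 + n * q)) → S n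
    cancelMultiple (q , P , Q) = cancel (1 + n * q) n (coprime-1+* n q) (sum∈ P) (sum∈ Q)
    multiple∈ : ∀ a b c .{{_ : NonZero a}} .{{_ : NonZero b}} → n ≡ a * a + b * b + c * c → S n
    multiple∈ a b c n≡ = cancelMultiple (multiple-isSumOfFourSquares a b c n≡)
    identity₁ : ∀ a → a * a ≡ a * (a * 1) + 0
    identity₁ = solve-∀
    identity₂ : ∀ a b → a * (a * 1) + (b * (b * 1) + 0) ≡ a * a + b * b + 0
    identity₂ = solve-∀
    identity₃ : ∀ a b c → a * (a * 1) + (b * (b * 1) + (c * (c * 1) + 0)) ≡ a * a + b * b + c * c
    identity₃ = solve-∀
    cases : ∀ j → j ≤ 4 → IsSumOfSquares j n → S n
    cases 0 _ ([]                             , 0≡n) = contradiction (sym 0≡n) (≢-nonZero⁻¹ n)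
    cases 1 _ (mk⁺ a ∷ []                     , eq)  = subst S (trans (identity₁ a) eq) (square∈ closed a)
    cases 2 _ (mk⁺ a ∷ mk⁺ b ∷ []             , eq)  = multiple∈ a b 0 (trans (sym eq) (identity₂ a b))
    cases 3 _ (mk⁺ a ∷ mk⁺ b ∷ mk⁺ c ∷ []     , eq)  = multiple∈ a b c (trans (sym eq) (identity₃ a b c))
    cases 4 _ P                                      = sum∈ P
    cases (suc (suc (suc (suc (suc _))))) (s≤s (s≤s (s≤s (s≤s ())))) _

  module _ {ℓ : Level} {S : ℕ → Set ℓ} (closed : IsClosed 3 S) where
    open IsClosed closed

    -- One good multiple of p settles all powers. If e is even, p^e is a square. If e = 2h + 1, then
    -- p^e m = (p^h)² · pm is again a sum of three squares, and m cancels.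
    primePower∈ : ∀ {p} → Prime p → ∀ m .{{_ : NonZero m}} → Coprime p m → S m → IsSumOfSquares 3 (p * m) →
                  ∀ e → S (p ^ e)
    primePower∈ {p} p-prime m p⊥m m∈ pm-isSum e = cases (even⊎odd e)
      where
      p≢0 : NonZero p
      p≢0 = prime⇒nonZero p-prime
      identity : ∀ p q m → q * q * (p * m) ≡ p * (q * q) * m
      identity = solve-∀
      cases : ∃[ h ] (e ≡ h + h ⊎ e ≡ suc (h + h)) → S (p ^ e)
      cases (h , inj₁ refl) = subst S (sym (^-distribˡ-+-* p h h)) (square∈ closed (p ^ h) {{m^n≢0 p h {{p≢0}}}})
      cases (h , inj₂ refl) = cancel m (p ^ e) {{it}} {{m^n≢0 p e {{p≢0}}}} (coprime-^ e p⊥m) m∈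
        (subst S (trans (identity p (p ^ h) m) (cong (λ x → p * x * m) (sym (^-distribˡ-+-* p h h))))
          (sum∈ (isSumOfSquares-scale (p ^ h) {{m^n≢0 p h {{p≢0}}}} pm-isSum)))

    -- The good multiple is 2 · 3 = 1² + 1² + 2², with cofactor 3 = 1² + 1² + 1².
    2^e∈ : ∀ e → S (2 ^ e)
    2^e∈ = primePower∈ prime[2] 3 (∤⇒coprime prime[2] (toWitnessFalse {a? = 2 ∣? 3} _))
      (sum∈ (isSumOfSquares-ones 3)) (1⁺ ∷ 1⁺ ∷ mk⁺ 2 ∷ [] , refl)

    prime[3] : Prime 3
    prime[3] = toWitness {a? = prime? 3} _

    3^e∈ : ∀ e → S (3 ^ e)
    3^e∈ = primePower∈ prime[3] 1 (Coprime.sym (Coprime.1-coprimeTo 3)) (1∈ closed) (isSumOfSquares-ones 3)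

    -- The factors 9 and m need not be coprime. Splitting off the 3-part, m = 3^e q, gives the
    -- coprime factorisation 9m = 3^(2+e) q.
    9*∈ : ∀ m .{{_ : NonZero m}} → (∀ q .{{_ : NonZero q}} → q ≤ m → S q) → S (9 * m)
    9*∈ m ≤m∈ with valuation prime[3] m
    ... | e , q , m≡ , 3⊥q = subst S eq
        (*-closed (3 ^ (2 + e)) q {{m^n≢0 3 (2 + e)}} {{q≢0}} (coprime-^ (2 + e) 3⊥q)
          (3^e∈ (2 + e)) (≤m∈ q {{q≢0}} q≤m))
      where
      q≢0 : NonZero q
      q≢0 = m*n≢0⇒n≢0 (3 ^ e) {{subst NonZero m≡ it}}
      q≤m : q ≤ m
      q≤m = subst (q ≤_) (sym m≡) (m≤n*m q (3 ^ e) {{m^n≢0 3 e}})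
      identity : ∀ x q → 3 * (3 * x) * q ≡ 9 * (x * q)
      identity = solve-∀
      eq : 3 ^ (2 + e) * q ≡ 9 * m
      eq = trans (identity (3 ^ e) q) (cong (9 *_) (sym m≡))

    -- 9(x² + 1) = (x + 2)² + (2x + 1)² + (2x − 2)²
    9[x²+1]-isSum : ∀ x → 1 < x → IsSumOfSquares 3 (9 * (x * x + 1))
    9[x²+1]-isSum (suc zero)    (s≤s ())
    9[x²+1]-isSum (suc (suc y)) _ =
      subst (IsSumOfSquares 3) (identity y) (Σ²₃ (4 + y) (5 + 2 * y) (2 + 2 * y))
      where
      identity : ∀ y → (4 + y) * (4 + y) + (5 + 2 * y) * (5 + 2 * y) + (2 + 2 * y) * (2 + 2 * y) ≡
                       9 * ((2 + y) * (2 + y) + 1)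
      identity = solve-∀

    module _ {p : ℕ} (p-prime : Prime p) (3<p : 3 < p) (<p∈ : ∀ m .{{_ : NonZero m}} → m < p → S m) where

      -- This is the case where one of the squares in x² + y² + 1 is 0 and mp shows only two
      -- positive terms. Passing to 9mp gives three. The cofactor 9m is coprime to p because p > 3,
      -- but it may exceed p, so its membership comes from `9*∈`.
      x²+1≡mp⇒p^e∈ : ∀ x m → x * x + 1 ≡ m * p → 0 < m → m < p → ∀ e → S (p ^ e)
      x²+1≡mp⇒p^e∈ x m eq 0<m m<p = primePower∈ p-prime (9 * m) {{m*n≢0 9 m}}
          (Coprime.sym (coprime-* (Coprime.sym p⊥9) (Coprime.sym (Coprime.prime⇒coprime p-prime m<p))))
          (9*∈ m λ q q≤m → <p∈ q (≤-<-trans q≤m m<p))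
          (subst (IsSumOfSquares 3) (trans (cong (9 *_) eq) (rearrange m p)) (9[x²+1]-isSum x 1<x))
        where
        instance
          m-nonZero : NonZero m
          m-nonZero = >-nonZero 0<m
        rearrange : ∀ m p → 9 * (m * p) ≡ p * (9 * m)
        rearrange = solve-∀
        p⊥3 : Coprime p 3
        p⊥3 = Coprime.prime⇒coprime p-prime 3<p
        p⊥9 : Coprime p 9
        p⊥9 = Coprime.sym (coprime-* {3} {3} (Coprime.sym p⊥3) (Coprime.sym p⊥3))
        3<x²+1⇒1<x : ∀ x → 3 < x * x + 1 → 1 < x
        3<x²+1⇒1<x zero          (s≤s ())
        3<x²+1⇒1<x (suc zero)    (s≤s (s≤s ()))
        3<x²+1⇒1<x (suc (suc _)) _ = s≤s (s≤s z≤n)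
        1<x : 1 < x
        1<x = 3<x²+1⇒1<x x (subst (3 <_) (sym eq) (<-≤-trans 3<p (m≤n*m p m)))

      largePrimePower∈ : ∀ e → S (p ^ e)
      largePrimePower∈ with x²+y²+1≡mp p-prime (λ p≡2 → contradiction (subst (3 <_) p≡2 3<p) λ { (s≤s (s≤s ())) })
      ... | zero  , y     , m , eq , 0<m , m<p = x²+1≡mp⇒p^e∈ y m eq 0<m m<p
      ... | suc x , zero  , m , eq , 0<m , m<p =
        x²+1≡mp⇒p^e∈ (suc x) m (trans (cong (_+ 1) (sym (+-identityʳ (suc x * suc x)))) eq) 0<m m<p
      ... | suc x , suc y , m , eq , 0<m , m<p =
        primePower∈ p-prime m {{m≢0}} (Coprime.prime⇒coprime p-prime {{m≢0}} m<p) (<p∈ m {{m≢0}} m<p)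
          (subst (IsSumOfSquares 3) (trans eq (*-comm m p)) (Σ²₃ (suc x) (suc y) 1))
        where
        m≢0 : NonZero m
        m≢0 = >-nonZero 0<m

  -- Strong induction on n = p^(1+e) q with q prime to p. The induction hypothesis is applied to q <
  -- n and to numbers below p ≤ n, from which the cofactors of p are obtained.
  closed-3 : ∀ {ℓ} {S : ℕ → Set ℓ} → IsClosed 3 S → ∀ n .{{_ : NonZero n}} → S n
  closed-3 {S = S} closed n = <-rec (λ n → 0 < n → S n) step n (>-nonZero⁻¹ n)
    where
    open IsClosed closed
    step : ∀ n → (∀ {m} → m < n → 0 < m → S m) → 0 < n → S n
    step n rec n>0 with n ≟ 1
    ... | yes refl = 1∈ closed
    ... | no  n≢1 with primeDivisor (≤∧≢⇒< n>0 (n≢1 ∘ sym))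
    ...   | p , p-prime , p∣n with valuation p-prime n {{>-nonZero n>0}}
    ...     | zero  , q , n≡ , p⊥q = contradiction
                (subst Prime (p⊥q (∣-refl , subst (p ∣_) (trans n≡ (*-identityˡ q)) p∣n)) p-prime) ¬prime[1]
    ...     | suc e , q , n≡ , p⊥q = subst S (sym n≡)
                (*-closed (p ^ suc e) q {{p^e≢0}} {{q≢0}} (coprime-^ (suc e) p⊥q)
                  (cases (p ≤? 3)) (rec q<n (>-nonZero⁻¹ q {{q≢0}})))
      where
      instance
        n-nonZero : NonZero n
        n-nonZero = >-nonZero n>0
        p-nonZero : NonZero p
        p-nonZero = prime⇒nonZero p-prime
      p^e≢0 : NonZero (p ^ suc e)
      p^e≢0 = m^n≢0 p (suc e)
      q≢0 : NonZero q
      q≢0 = m*n≢0⇒n≢0 (p ^ suc e) {{subst NonZero n≡ n-nonZero}}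
      1<p : 1 < p
      1<p = nonTrivial⇒n>1 p {{prime⇒nonTrivial p-prime}}
      q<n : q < n
      q<n = subst (q <_) (sym n≡) (<-≤-trans (m<m*n q p {{q≢0}} 1<p)
        (≤-trans (≤-reflexive (*-comm q p)) (*-monoˡ-≤ q (m≤m*n p (p ^ e) {{m^n≢0 p e}}))))
      p≤3⇒p≡2⊎p≡3 : p ≤ 3 → p ≡ 2 ⊎ p ≡ 3
      p≤3⇒p≡2⊎p≡3 p≤3 with m≤n⇒m<n∨m≡n p≤3
      ... | inj₁ (s≤s p≤2) = inj₁ (≤-antisym p≤2 1<p)
      ... | inj₂ p≡3       = inj₂ p≡3
      cases : Dec (p ≤ 3) → S (p ^ suc e)
      cases (yes p≤3) with p≤3⇒p≡2⊎p≡3 p≤3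
      ... | inj₁ refl = 2^e∈ closed (suc e)
      ... | inj₂ refl = 3^e∈ closed (suc e)
      cases (no p≰3) = largePrimePower∈ closed p-prime (≰⇒> p≰3)
        (λ m m<p → rec (<-≤-trans m<p (∣⇒≤ p∣n)) (>-nonZero⁻¹ m)) (suc e)

  closed-all : ∀ {ℓ} k {S : ℕ → Set ℓ} → 3 ≤ k → IsClosed k S → ∀ n .{{_ : NonZero n}} → S n
  closed-all 0 () _
  closed-all 1 (s≤s ()) _
  closed-all 2 (s≤s (s≤s ())) _
  closed-all 3 _ = closed-3
  closed-all 4 _ = closed-4
  closed-all (suc (suc (suc (suc (suc r))))) _ = closed-≥5 r

open SumsOfSquares

-- Functions with values in a torsion-free ring

mk⁺-cong : ∀ {m n} .{{_ : NonZero m}} .{{_ : NonZero n}} → m ≡ n → mk⁺ m ≡ mk⁺ n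
mk⁺-cong refl = refl

TorsionFree : ∀ {a ℓ} → CommutativeRing a ℓ → Set (a Level.⊔ ℓ)
TorsionFree R = ∀ n x → suc n · x ≈ 0# → x ≈ 0#
  where
  open CommutativeRing R using (_≈_; 0#; rawRing)
  open Algebra.Definitions.RawSemiring (RawRing.rawSemiring rawRing) using () renaming (_×_ to _·_)

module InTorsionFreeRing {a ℓ : Level} (R : CommutativeRing a ℓ) (torsionFree : TorsionFree R) where

  open CommutativeRing R hiding (zero) renaming (refl to ≈-refl; sym to ≈-sym; trans to ≈-trans)
  open Algebra.Definitions.RawSemiring (RawRing.rawSemiring rawRing) using (sum; _^_) renaming (_×_ to _·_)
  open Algebra.Properties.CommutativeMonoid.Mult +-commutativeMonoid using (×-distrib-+)
  open Algebra.Properties.CommutativeMonoid.Sum +-commutativeMonoid using (sum-cong-≋; ∑-distrib-+)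
  open Algebra.Properties.CommutativeSemiring.Exp commutativeSemiring using (^-congˡ; ^-distrib-*)
  open Algebra.Properties.Group +-group using (∙-cancelˡ; ∙-cancelʳ; x∙y⁻¹≈ε⇒x≈y)
  open Algebra.Properties.Semiring.Mult semiring
    using (×-congʳ; ×-congˡ; ×-homo-1; ×-homo-+; ×-assocˡ; ×-comm-*; ×1-homo-*)
  open import Relation.Binary.Reasoning.Setoid setoid

  -- Functions whose sums depend only on the sum of squares

  ∑ : ∀ {j} → (ℕ⁺ → Carrier) → Vec ℕ⁺ j → Carrier
  ∑ E xs = sum (λ i → E (lookup xs i))

  Balanced : ℕ → (ℕ⁺ → Carrier) → Set ℓ
  Balanced j E = (xs ys : Vec ℕ⁺ j) → Σ² xs ≡ Σ² ys → ∑ E xs ≈ ∑ E ys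

  ∑-++ : ∀ {i j} E (xs : Vec ℕ⁺ i) (ys : Vec ℕ⁺ j) → ∑ E (xs ++ ys) ≈ ∑ E xs + ∑ E ys
  ∑-++ E []       ys = ≈-sym (+-identityˡ (∑ E ys))
  ∑-++ E (x ∷ xs) ys = ≈-trans (+-congˡ (∑-++ E xs ys)) (≈-sym (+-assoc (E x) (∑ E xs) (∑ E ys)))

  -- Padding both sides with ones keeps the sums of squares equal, and the padding cancels
  -- afterwards. So trades of three or four terms are available for all larger numbers of terms.
  balanced-≤ : ∀ i {j} E → Balanced (j ℕ.+ i) E → Balanced j E
  balanced-≤ i {j} E balanced xs ys eq = ∙-cancelʳ (∑ E ones) (∑ E xs) (∑ E ys) (begin
    ∑ E xs + ∑ E ones ≈⟨ ∑-++ E xs ones ⟨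
    ∑ E (xs ++ ones)  ≈⟨ balanced (xs ++ ones) (ys ++ ones)
                           (≡.trans (Σ²-++ xs ones) (≡.trans (≡.cong (ℕ._+ Σ² ones) eq) (≡.sym (Σ²-++ ys ones)))) ⟩
    ∑ E (ys ++ ones)  ≈⟨ ∑-++ E ys ones ⟩
    ∑ E ys + ∑ E ones ∎)
    where
    ones : Vec ℕ⁺ i
    ones = replicate i 1⁺

  balanced-+ : ∀ {j} E G → Balanced j E → Balanced j G → Balanced j (λ n → E n + G n)
  balanced-+ E G E-balanced G-balanced xs ys eq = begin
    ∑ (λ n → E n + G n) xs ≈⟨ ∑-distrib-+ (λ i → E (lookup xs i)) (λ i → G (lookup xs i)) ⟩
    ∑ E xs + ∑ G xs        ≈⟨ +-cong (E-balanced xs ys eq) (G-balanced xs ys eq) ⟩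
    ∑ E ys + ∑ G ys        ≈⟨ ∑-distrib-+ (λ i → E (lookup ys i)) (λ i → G (lookup ys i)) ⟨
    ∑ (λ n → E n + G n) ys ∎

  n·0≈0 : ∀ n → n · 0# ≈ 0#
  n·0≈0 zero    = ≈-refl
  n·0≈0 (suc n) = ≈-trans (+-identityˡ (n · 0#)) (n·0≈0 n)

  balanced-× : ∀ {j} m E → Balanced j E → Balanced j (λ n → m · E n)
  balanced-× m E balanced xs ys eq = begin
    ∑ (λ n → m · E n) xs ≈⟨ ∑-× xs ⟩
    m · ∑ E xs           ≈⟨ ×-congʳ m (balanced xs ys eq) ⟩
    m · ∑ E ys           ≈⟨ ∑-× ys ⟨
    ∑ (λ n → m · E n) ys ∎
    where
    ∑-× : ∀ {j} (zs : Vec ℕ⁺ j) → ∑ (λ n → m · E n) zs ≈ m · ∑ E zs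
    ∑-× []       = ≈-sym (n·0≈0 m)
    ∑-× (z ∷ zs) = ≈-trans (+-congˡ (∑-× zs)) (≈-sym (×-distrib-+ (E z) (∑ E zs) m))

  ∑-square : ∀ {j} b (xs : Vec ℕ⁺ j) → ∑ (λ n → (value n ℕ.^ 2) · b) xs ≈ Σ² xs · b
  ∑-square b []       = ≈-refl
  ∑-square b (x ∷ xs) = ≈-trans (+-congˡ (∑-square b xs)) (≈-sym (×-homo-+ b (value x ℕ.^ 2) (Σ² xs)))

  balanced-square : ∀ {j} b → Balanced j (λ n → (value n ℕ.^ 2) · b)
  balanced-square b xs ys eq = begin
    ∑ (λ n → (value n ℕ.^ 2) · b) xs ≈⟨ ∑-square b xs ⟩
    Σ² xs · b                        ≈⟨ ×-congˡ eq ⟩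
    Σ² ys · b                        ≈⟨ ∑-square b ys ⟨
    ∑ (λ n → (value n ℕ.^ 2) · b) ys ∎

  balanced-const : ∀ {j} d → Balanced j (λ _ → d)
  balanced-const d xs ys _ = ≈-refl

  -- Balanced functions that vanish at 1 and 3

  module Parity (E : ℕ⁺ → Carrier) (balanced : Balanced 3 E)
                (E1≈0 : E (mk⁺ 1) ≈ 0#) (E3≈0 : E (mk⁺ 3) ≈ 0#) where

    -- Three-term trades cannot do better: a sum of three squares is congruent modulo 4 to the
    -- number of its odd terms, so any multiple of the indicator function of the even numbers is
    -- balanced. With four terms, zero and four odd terms collide modulo 4, which is what
    -- `balanced₄⇒≈0` exploits.
    parity : ℕ → Carrier
    parity 0             = E (mk⁺ 2)
    parity 1             = 0#
    parity (suc (suc n)) = parity n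

    trade-cancel : ∀ {x y y′ z z′ u v} → x + (y + (z + 0#)) ≈ u + (y′ + (z′ + 0#)) →
              y ≈ v → y′ ≈ v → z ≈ 0# → z′ ≈ 0# → x ≈ u
    trade-cancel {x} {y} {y′} {z} {z′} {u} {v} eq y≈v y′≈v z≈0 z′≈0 =
      ∙-cancelʳ (y + (z + 0#)) x u (≈-trans eq (+-congˡ (+-cong (≈-trans y′≈v (≈-sym y≈v))
        (+-congʳ (≈-trans z′≈0 (≈-sym z≈0))))))

    trade : ∀ x x′ y y′ z z′ .{{_ : NonZero x}} .{{_ : NonZero x′}} .{{_ : NonZero y}} .{{_ : NonZero y′}}
              .{{_ : NonZero z}} .{{_ : NonZero z′}} {v} →
              Σ² (mk⁺ x ∷ mk⁺ y ∷ mk⁺ z ∷ []) ≡ Σ² (mk⁺ x′ ∷ mk⁺ y′ ∷ mk⁺ z′ ∷ []) →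
              E (mk⁺ y) ≈ v → E (mk⁺ y′) ≈ v → E (mk⁺ z) ≈ 0# → E (mk⁺ z′) ≈ 0# → E (mk⁺ x) ≈ E (mk⁺ x′)
    trade x x′ y y′ z z′ eq = trade-cancel (balanced (mk⁺ x ∷ mk⁺ y ∷ mk⁺ z ∷ []) (mk⁺ x′ ∷ mk⁺ y′ ∷ mk⁺ z′ ∷ []) eq)

    E5≈0 : E (mk⁺ 5) ≈ 0#
    E5≈0 = ≈-trans (trade 5 3 1 3 1 3 refl E1≈0 E3≈0 E1≈0 E3≈0) E3≈0

    -- The trade 1² + 4² + 4² = 5² + 2² + 2² yields only 2E(4) = 2E(2), hence the appeal to
    -- torsion-freeness.
    E4≈E2 : E (mk⁺ 4) ≈ E (mk⁺ 2)
    E4≈E2 = x∙y⁻¹≈ε⇒x≈y _ _ (torsionFree 1 _ (begin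
      2 · (E (mk⁺ 4) - E (mk⁺ 2))             ≈⟨ ×-distrib-+ (E (mk⁺ 4)) (- E (mk⁺ 2)) 2 ⟩
      2 · E (mk⁺ 4) + 2 · (- E (mk⁺ 2))       ≈⟨ +-congʳ 2E4≈2E2 ⟩
      2 · E (mk⁺ 2) + 2 · (- E (mk⁺ 2))       ≈⟨ ×-distrib-+ (E (mk⁺ 2)) (- E (mk⁺ 2)) 2 ⟨
      2 · (E (mk⁺ 2) - E (mk⁺ 2))             ≈⟨ ×-congʳ 2 (-‿inverseʳ (E (mk⁺ 2))) ⟩
      2 · 0#                                  ≈⟨ ≈-trans (+-identityˡ _) (+-identityˡ 0#) ⟩
      0#                                      ∎))
      where
      2E4≈2E2 : 2 · E (mk⁺ 4) ≈ 2 · E (mk⁺ 2)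
      2E4≈2E2 = ∙-cancelˡ 0# _ _ (≈-trans (+-congʳ (≈-sym E1≈0)) (≈-trans
        (balanced (mk⁺ 1 ∷ mk⁺ 4 ∷ mk⁺ 4 ∷ []) (mk⁺ 5 ∷ mk⁺ 2 ∷ mk⁺ 2 ∷ []) refl) (+-congʳ E5≈0)))

    Claim : ℕ → Set ℓ
    Claim n = .{{_ : NonZero n}} → E (mk⁺ n) ≈ parity n

    -- The trade from 2m + 1 to 2m - 1 with m = 3 + j, padded by 1². The companions m - 2 and m + 2
    -- have equal parity, so `E` agrees on them by induction.
    odd-step : ∀ j → (∀ {m} → m < 7 ℕ.+ 2 ℕ.* j → Claim m) → E (mk⁺ (7 ℕ.+ 2 ℕ.* j)) ≈ parity (7 ℕ.+ 2 ℕ.* j)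
    odd-step j rec = ≈-trans
      (trade (7 ℕ.+ 2 ℕ.* j) (5 ℕ.+ 2 ℕ.* j) (1 ℕ.+ j) (5 ℕ.+ j) 1 1 (identity j)
        (rec (<7+2j 1 (s≤s (s≤s z≤n)))) (rec (<7+2j 5 (ℕ.m≤m+n 6 1))) E1≈0 E1≈0)
      (rec (ℕ.+-monoˡ-< (2 ℕ.* j) (ℕ.m≤m+n 6 1)))
      where
      <7+2j : ∀ i → i < 7 → i ℕ.+ j < 7 ℕ.+ 2 ℕ.* j
      <7+2j i i<7 = ℕ.+-mono-<-≤ i<7 (ℕ.m≤n*m j 2)
      identity : ∀ j → (7 ℕ.+ 2 ℕ.* j) ℕ.* ((7 ℕ.+ 2 ℕ.* j) ℕ.* 1) ℕ.+ ((1 ℕ.+ j) ℕ.* ((1 ℕ.+ j) ℕ.* 1) ℕ.+ 1) ≡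
                       (5 ℕ.+ 2 ℕ.* j) ℕ.* ((5 ℕ.+ 2 ℕ.* j) ℕ.* 1) ℕ.+ ((5 ℕ.+ j) ℕ.* ((5 ℕ.+ j) ℕ.* 1) ℕ.+ 1)
      identity = solve-∀

    -- The trade from 2m + 2 to 2m - 2 with m = 5 + j, the least m for which m - 4 is positive being
    -- 5.
    even-step : ∀ j → (∀ {m} → m < 12 ℕ.+ 2 ℕ.* j → Claim m) → E (mk⁺ (12 ℕ.+ 2 ℕ.* j)) ≈ parity (12 ℕ.+ 2 ℕ.* j)
    even-step j rec = ≈-trans
      (trade (12 ℕ.+ 2 ℕ.* j) (8 ℕ.+ 2 ℕ.* j) (1 ℕ.+ j) (9 ℕ.+ j) 1 1 (identity j)
        (rec (<12+2j 1 (s≤s (s≤s z≤n)))) (rec (<12+2j 9 (ℕ.m≤m+n 10 2))) E1≈0 E1≈0)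
      (rec (ℕ.+-monoˡ-< (2 ℕ.* j) (ℕ.m≤m+n 9 3)))
      where
      <12+2j : ∀ i → i < 12 → i ℕ.+ j < 12 ℕ.+ 2 ℕ.* j
      <12+2j i i<12 = ℕ.+-mono-<-≤ i<12 (ℕ.m≤n*m j 2)
      identity : ∀ j → (12 ℕ.+ 2 ℕ.* j) ℕ.* ((12 ℕ.+ 2 ℕ.* j) ℕ.* 1) ℕ.+ ((1 ℕ.+ j) ℕ.* ((1 ℕ.+ j) ℕ.* 1) ℕ.+ 1) ≡
                       (8 ℕ.+ 2 ℕ.* j) ℕ.* ((8 ℕ.+ 2 ℕ.* j) ℕ.* 1) ℕ.+ ((9 ℕ.+ j) ℕ.* ((9 ℕ.+ j) ℕ.* 1) ℕ.+ 1)
      identity = solve-∀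

    step : ∀ n → (∀ {m} → m < n → Claim m) → Claim n
    step n rec with even⊎odd n
    ... | 0 , inj₁ refl = contradiction refl (ℕ.≢-nonZero⁻¹ 0)
    ... | 1 , inj₁ refl = ≈-refl
    ... | 2 , inj₁ refl = E4≈E2
    -- At 6, 8 and 10 the term m - 4 of the even trade is not positive. The replacements are 6² + 3²
    -- + 3² = 2² + 5² + 5², 8² + 1² + 1² = 4² + 5² + 5² and 10² + 1² + 1² = 2² + 7² + 7².
    ... | 3 , inj₁ refl = trade 6 2 3 5 3 5 refl E3≈0 E5≈0 E3≈0 E5≈0
    ... | 4 , inj₁ refl = ≈-trans (trade 8 4 1 5 1 5 refl E1≈0 E5≈0 E1≈0 E5≈0) E4≈E2
    ... | 5 , inj₁ refl = trade 10 2 1 7 1 7 refl E1≈0 E7≈0 E1≈0 E7≈0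
      where
      E7≈0 : E (mk⁺ 7) ≈ 0#
      E7≈0 = rec (ℕ.m≤m+n 8 2)
    ... | suc (suc (suc (suc (suc (suc j))))) , inj₁ refl =
      ≡.subst Claim (identity j) (even-step j (λ {m} m< → rec {m} (≡.subst (m <_) (identity j) m<)))
      where
      identity : ∀ j → 12 ℕ.+ 2 ℕ.* j ≡ 6 ℕ.+ j ℕ.+ (6 ℕ.+ j)
      identity = solve-∀
    ... | 0 , inj₂ refl = E1≈0
    ... | 1 , inj₂ refl = E3≈0
    ... | 2 , inj₂ refl = E5≈0
    ... | suc (suc (suc j)) , inj₂ refl =
      ≡.subst Claim (identity j) (odd-step j (λ {m} m< → rec {m} (≡.subst (m <_) (identity j) m<)))
      where
      identity : ∀ j → 7 ℕ.+ 2 ℕ.* j ≡ suc (3 ℕ.+ j ℕ.+ (3 ℕ.+ j))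
      identity = solve-∀

    E≈parity : ∀ n → E n ≈ parity (value n)
    E≈parity (mk⁺ n) = <-rec Claim step n

  m·x+m·-x≈0 : ∀ m x → m · x + m · (- x) ≈ 0#
  m·x+m·-x≈0 m x = begin
    m · x + m · (- x)  ≈⟨ ×-distrib-+ x (- x) m ⟨
    m · (x - x)        ≈⟨ ×-congʳ m (-‿inverseʳ x) ⟩
    m · 0#             ≈⟨ n·0≈0 m ⟩
    0#                 ∎

  balanced₄⇒≈0 : ∀ E → Balanced 4 E → E (mk⁺ 1) ≈ 0# → E (mk⁺ 3) ≈ 0# → ∀ n → E n ≈ 0#
  balanced₄⇒≈0 E balanced E1≈0 E3≈0 n = ≈-trans (E≈parity n) (parity≈0 (value n))
    where
    open Parity E (balanced-≤ 1 E balanced) E1≈0 E3≈0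
    E2≈0 : E (mk⁺ 2) ≈ 0#
    E2≈0 = torsionFree 3 (E (mk⁺ 2)) (begin
      4 · E (mk⁺ 2)                                 ≈⟨ +-congʳ E4≈E2 ⟨
      E (mk⁺ 4) + 3 · E (mk⁺ 2)                     ≈⟨ balanced (mk⁺ 4 ∷ mk⁺ 2 ∷ mk⁺ 2 ∷ mk⁺ 2 ∷ [])
                                                                (mk⁺ 5 ∷ mk⁺ 1 ∷ mk⁺ 1 ∷ mk⁺ 1 ∷ []) refl ⟩
      E (mk⁺ 5) + 3 · E (mk⁺ 1)                     ≈⟨ +-cong E5≈0 (×-congʳ 3 E1≈0) ⟩
      4 · 0#                                        ≈⟨ n·0≈0 4 ⟩
      0#                                            ∎)
    parity≈0 : ∀ n → parity n ≈ 0#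
    parity≈0 0             = E2≈0
    parity≈0 1             = ≈-refl
    parity≈0 (suc (suc n)) = parity≈0 n

  -- E(n) = 8 D(n) − (n² − 1) D(3) vanishes at 1 and 3, hence everywhere.
  balanced₄∧zero⇒≈0 : ∀ D → Balanced 4 D → D (mk⁺ 1) ≈ 0# →
                      ∀ m → D (mk⁺ (2 ℕ.+ m)) ≈ 0# → ∀ n → D n ≈ 0#
  balanced₄∧zero⇒≈0 D balanced D1≈0 m Dk≈0 = balanced₄⇒≈0 D balanced D1≈0 d≈0
    where
    d : Carrier
    d = D (mk⁺ 3)
    Q : ℕ⁺ → Carrier
    Q n = (value n ℕ.^ 2) · (- d) + d
    -- The factor 8 = 3² - 1 replaces a division of D(3) by 8.
    E : ℕ⁺ → Carrier
    E n = 8 · D n + Q n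
    E-balanced : Balanced 4 E
    E-balanced = balanced-+ (λ n → 8 · D n) Q (balanced-× 8 D balanced)
      (balanced-+ (λ n → (value n ℕ.^ 2) · (- d)) (λ _ → d) (balanced-square (- d)) (balanced-const d))
    E1≈0 : E (mk⁺ 1) ≈ 0#
    E1≈0 = begin
      8 · D (mk⁺ 1) + (1 · (- d) + d) ≈⟨ +-cong (×-congʳ 8 D1≈0) (+-congʳ (×-homo-1 (- d))) ⟩
      8 · 0# + (- d + d)              ≈⟨ +-cong (n·0≈0 8) (-‿inverseˡ d) ⟩
      0# + 0#                         ≈⟨ +-identityˡ 0# ⟩
      0#                              ∎
    E3≈0 : E (mk⁺ 3) ≈ 0#
    E3≈0 = begin
      8 · d + (9 · (- d) + d)         ≈⟨ +-congˡ (+-comm (9 · (- d)) d) ⟩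
      8 · d + (d + 9 · (- d))         ≈⟨ +-assoc (8 · d) d (9 · (- d)) ⟨
      (8 · d + d) + 9 · (- d)         ≈⟨ +-congʳ (+-comm (8 · d) d) ⟩
      9 · d + 9 · (- d)               ≈⟨ m·x+m·-x≈0 9 d ⟩
      0#                              ∎
    -- The square (2 + m)² is 2 + j by computation. As D(2 + m) = 0, the vanishing of E there says
    -- (2 + j)(-d) + d = 0, that is, (1 + j) d = 0.
    j : ℕ
    j = ℕ.pred (ℕ.pred ((2 ℕ.+ m) ℕ.^ 2))
    d≈0 : d ≈ 0#
    d≈0 = torsionFree j d (∙-cancelˡ d _ _ (begin
      d + suc j · d                                   ≈⟨ +-identityʳ _ ⟨
      (2 ℕ.+ j) · d + 0#                              ≈⟨ +-congˡ Qk≈0 ⟨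
      (2 ℕ.+ j) · d + ((2 ℕ.+ j) · (- d) + d)         ≈⟨ +-assoc ((2 ℕ.+ j) · d) ((2 ℕ.+ j) · (- d)) d ⟨
      ((2 ℕ.+ j) · d + (2 ℕ.+ j) · (- d)) + d         ≈⟨ +-congʳ (m·x+m·-x≈0 (2 ℕ.+ j) d) ⟩
      0# + d                                          ≈⟨ +-comm 0# d ⟩
      d + 0#                                          ∎))
      where
      Qk≈0 : (2 ℕ.+ j) · (- d) + d ≈ 0#
      Qk≈0 = begin
        Q (mk⁺ (2 ℕ.+ m))                             ≈⟨ +-identityˡ _ ⟨
        0# + Q (mk⁺ (2 ℕ.+ m))                        ≈⟨ +-congʳ (≈-trans (×-congʳ 8 Dk≈0) (n·0≈0 8)) ⟨
        E (mk⁺ (2 ℕ.+ m))                             ≈⟨ balanced₄⇒≈0 E E-balanced E1≈0 E3≈0 (mk⁺ (2 ℕ.+ m)) ⟩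
        0#                                            ∎

  -- The function f: first its square, then its fixed points

  module _ (k : ℕ) .{{_ : NonZero k}} (f : ℕ⁺ → Carrier) (f1≈1 : f 1⁺ ≈ 1#)
    (f-* : ∀ m n → Coprime (value m) (value n) → f (m *⁺ n) ≈ f m * f n)
    (f-Σ² : (x : Fin k → ℕ⁺) → f (sumOfSquares x) ≈ sum (λ i → f (x i) ^ 2)) where

    F : ℕ⁺ → Carrier
    F n = f n ^ 2

    f-≡ : ∀ {m n} .{{_ : NonZero m}} .{{_ : NonZero n}} → m ≡ n → f (mk⁺ m) ≈ f (mk⁺ n)
    f-≡ refl = ≈-refl

    F-balanced : Balanced k F
    F-balanced xs ys eq = begin
      ∑ F xs                     ≈⟨ f-Σ² (lookup xs) ⟨
      f (sumOfSquares (lookup xs))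
        ≈⟨ f-≡ {{sumOfSquares-nonZero (lookup xs)}} {{sumOfSquares-nonZero (lookup ys)}} eq ⟩
      f (sumOfSquares (lookup ys)) ≈⟨ f-Σ² (lookup ys) ⟩
      ∑ F ys                     ∎

    D : ℕ⁺ → Carrier
    D n = F n + (value n ℕ.^ 2) · (- 1#)

    D-balanced : Balanced k D
    D-balanced = balanced-+ F (λ n → (value n ℕ.^ 2) · (- 1#)) F-balanced (balanced-square (- 1#))

    f≈m·1⇒D≈0 : ∀ n → f n ≈ value n · 1# → D n ≈ 0#
    f≈m·1⇒D≈0 n fn≈n = ≈-trans (+-congʳ (begin
      f n * (f n * 1#)            ≈⟨ *-congˡ (*-identityʳ (f n)) ⟩
      f n * f n                   ≈⟨ *-cong fn≈n fn≈n ⟩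
      value n · 1# * (value n · 1#) ≈⟨ ×1-homo-* (value n) (value n) ⟨
      (value n ℕ.* value n) · 1#  ≈⟨ ×-congˡ (≡.cong (value n ℕ.*_) (≡.sym (ℕ.*-identityʳ (value n)))) ⟩
      (value n ℕ.^ 2) · 1#        ∎)) (m·x+m·-x≈0 (value n ℕ.^ 2) 1#)

    D≈0⇒F≈ : ∀ n → D n ≈ 0# → F n ≈ (value n ℕ.^ 2) · 1#
    D≈0⇒F≈ n Dn≈0 = ∙-cancelʳ _ _ _ (≈-trans Dn≈0 (≈-sym (m·x+m·-x≈0 (value n ℕ.^ 2) 1#)))

    D1≈0 : D 1⁺ ≈ 0#
    D1≈0 = f≈m·1⇒D≈0 1⁺ (≈-trans f1≈1 (≈-sym (×-homo-1 1#)))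

    -- Because k = 1² + ... + 1² and f(1) = 1. If k = 3 this is D(3) = 0 at once; if k ≥ 4 it is the
    -- zero of D that forces D(3) = 0.
    fk≈k : f (mk⁺ k) ≈ k · 1#
    fk≈k = begin
      f (mk⁺ k)                                ≈⟨ f-≡ {{it}} {{sumOfSquares-nonZero (lookup ones)}}
                                                    (≡.sym (≡.trans (Σ²-replicate k 1⁺) (ℕ.*-identityʳ k))) ⟩
      f (sumOfSquares (lookup ones))           ≈⟨ f-Σ² (lookup ones) ⟩
      ∑ F ones                                 ≈⟨ ∑-ones k ⟩
      k · 1#                                   ∎
      where
      ones : Vec ℕ⁺ k
      ones = replicate k 1⁺
      F1≈1 : F 1⁺ ≈ 1#
      F1≈1 = ≈-trans (*-cong f1≈1 (≈-trans (*-identityʳ _) f1≈1)) (*-identityʳ 1#)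
      ∑-ones : ∀ j → ∑ F (replicate j 1⁺) ≈ j · 1#
      ∑-ones zero    = ≈-refl
      ∑-ones (suc j) = +-cong F1≈1 (∑-ones j)

    Dk≈0 : D (mk⁺ k) ≈ 0#
    Dk≈0 = f≈m·1⇒D≈0 (mk⁺ k) fk≈k

    F≈D+n² : ∀ n → F n ≈ D n + (value n ℕ.^ 2) · 1#
    F≈D+n² n = begin
      F n                           ≈⟨ +-identityʳ (F n) ⟨
      F n + 0#                      ≈⟨ +-congˡ (≈-trans (+-comm _ _) (m·x+m·-x≈0 (value n ℕ.^ 2) 1#)) ⟨
      F n + ((value n ℕ.^ 2) · (- 1#) + (value n ℕ.^ 2) · 1#) ≈⟨ +-assoc (F n) _ _ ⟨
      D n + (value n ℕ.^ 2) · 1#    ∎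

    F6≈F2*F3 : F (mk⁺ 6) ≈ F (mk⁺ 2) * F (mk⁺ 3)
    F6≈F2*F3 = ≈-trans (^-congˡ 2 (f-* (mk⁺ 2) (mk⁺ 3) (Coprime.sym (Coprime.coprime-+ (Coprime.1-coprimeTo 2)))))
      (^-distrib-* (f (mk⁺ 2)) (f (mk⁺ 3)) 2)

    -- By parity D(6) = D(2) = d, and F(3) = 9, so F(6) = F(2) F(3) reads d + 36 = 9(d + 4), whence
    -- 8d = 0.
    balanced₃∧D3≈0⇒D≈0 : Balanced 3 D → D (mk⁺ 3) ≈ 0# → ∀ n → D n ≈ 0#
    balanced₃∧D3≈0⇒D≈0 D-balanced₃ D3≈0 n = ≈-trans (E≈parity n) (parity≈0 (value n))
      where
      open Parity D D-balanced₃ D1≈0 D3≈0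
      d : Carrier
      d = D (mk⁺ 2)
      9d+36≈d+36 : 9 · d + 36 · 1# ≈ d + 36 · 1#
      9d+36≈d+36 = begin
        9 · d + 36 · 1#                       ≈⟨ +-congˡ (×-assocˡ 1# 9 4) ⟨
        9 · d + 9 · (4 · 1#)                  ≈⟨ ×-distrib-+ d (4 · 1#) 9 ⟨
        9 · (d + 4 · 1#)                      ≈⟨ ×-congʳ 9 (F≈D+n² (mk⁺ 2)) ⟨
        9 · F (mk⁺ 2)                         ≈⟨ ×-congʳ 9 (*-identityʳ (F (mk⁺ 2))) ⟨
        9 · (F (mk⁺ 2) * 1#)                  ≈⟨ ×-comm-* 9 (F (mk⁺ 2)) 1# ⟨
        F (mk⁺ 2) * 9 · 1#                    ≈⟨ *-congˡ (D≈0⇒F≈ (mk⁺ 3) D3≈0) ⟨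
        F (mk⁺ 2) * F (mk⁺ 3)                 ≈⟨ F6≈F2*F3 ⟨
        F (mk⁺ 6)                             ≈⟨ F≈D+n² (mk⁺ 6) ⟩
        D (mk⁺ 6) + 36 · 1#                   ≈⟨ +-congʳ (E≈parity (mk⁺ 6)) ⟩
        d + 36 · 1#                           ∎
      d≈0 : d ≈ 0#
      d≈0 = torsionFree 7 d (∙-cancelˡ d _ _
        (≈-trans (∙-cancelʳ (36 · 1#) _ _ 9d+36≈d+36) (≈-sym (+-identityʳ d))))
      parity≈0 : ∀ n → parity n ≈ 0#
      parity≈0 0             = d≈0
      parity≈0 1             = ≈-refl
      parity≈0 (suc (suc n)) = parity≈0 n

    D≈0 : 3 ℕ.≤ k → ∀ n → D n ≈ 0#
    D≈0 3≤k with ℕ.m≤n⇒m<n∨m≡n 3≤k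
    ... | inj₁ 4≤k = balanced₄∧zero⇒≈0 D
      (balanced-≤ (k ℕ.∸ 4) D (≡.subst (λ j → Balanced j D) (≡.sym (ℕ.m+[n∸m]≡n 4≤k)) D-balanced))
      D1≈0 (k ℕ.∸ 2)
      (≡.subst (λ n → D n ≈ 0#) (mk⁺-cong (≡.sym (ℕ.m+[n∸m]≡n (ℕ.≤-trans (s≤s (s≤s z≤n)) 3≤k)))) Dk≈0)
    ... | inj₂ 3≡k = balanced₃∧D3≈0⇒D≈0 (≡.subst (λ j → Balanced j D) (≡.sym 3≡k) D-balanced)
      (≡.subst (λ n → D n ≈ 0#) (mk⁺-cong (≡.sym 3≡k)) Dk≈0)

    Fixed : ℕ → Set ℓ
    Fixed n = .{{_ : NonZero n}} → f (mk⁺ n) ≈ n · 1#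

    fixed-closed : 3 ℕ.≤ k → IsClosed k Fixed
    fixed-closed 3≤k = record
      { sum∈     = λ { (xs , refl) → Σ²-fixed xs }
      ; *-closed = *-fixed
      ; cancel   = cancel-fixed
      }
      where
      Σ²-fixed : ∀ xs → Fixed (Σ² xs)
      Σ²-fixed xs = begin
        -- `Σ² xs` is by definition the value of `sumOfSquares (lookup xs)`; only the proofs of
        -- positivity differ.
        f (mk⁺ (Σ² xs))                ≈⟨ f-≡ {{it}} {{sumOfSquares-nonZero (lookup xs)}} refl ⟩
        f (sumOfSquares (lookup xs))   ≈⟨ f-Σ² (lookup xs) ⟩
        ∑ F xs                         ≈⟨ sum-cong-≋ (λ i → D≈0⇒F≈ (lookup xs i) (D≈0 3≤k (lookup xs i))) ⟩
        ∑ (λ n → (value n ℕ.^ 2) · 1#) xs ≈⟨ ∑-square 1# xs ⟩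
        Σ² xs · 1#                     ∎
      *-fixed : ∀ m n .{{_ : NonZero m}} .{{_ : NonZero n}} → Coprime m n → Fixed m → Fixed n → Fixed (m ℕ.* n)
      *-fixed m n m⊥n fm≈m fn≈n = begin
        f (mk⁺ (m ℕ.* n))       ≈⟨ f-≡ {{it}} {{ℕ.m*n≢0 m n}} refl ⟩
        f (mk⁺ m *⁺ mk⁺ n)      ≈⟨ f-* (mk⁺ m) (mk⁺ n) m⊥n ⟩
        f (mk⁺ m) * f (mk⁺ n)   ≈⟨ *-cong fm≈m fn≈n ⟩
        m · 1# * n · 1#         ≈⟨ ×1-homo-* m n ⟨
        (m ℕ.* n) · 1#          ∎
      cancel-fixed : ∀ m n .{{_ : NonZero m}} .{{_ : NonZero n}} →
                     Coprime n m → Fixed m → Fixed (n ℕ.* m) → Fixed n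
      cancel-fixed m@(suc m′) n n⊥m fm≈m fnm≈nm = x∙y⁻¹≈ε⇒x≈y _ _ (torsionFree m′ _ (begin
        m · (f (mk⁺ n) - n · 1#)                 ≈⟨ ×-distrib-+ (f (mk⁺ n)) (- (n · 1#)) m ⟩
        m · f (mk⁺ n) + m · (- (n · 1#))         ≈⟨ +-congʳ m·fn≈m·n ⟩
        m · (n · 1#) + m · (- (n · 1#))          ≈⟨ m·x+m·-x≈0 m (n · 1#) ⟩
        0#                                       ∎))
        where
        m·fn≈m·n : m · f (mk⁺ n) ≈ m · (n · 1#)
        m·fn≈m·n = begin
          m · f (mk⁺ n)          ≈⟨ ×-congʳ m (*-identityʳ (f (mk⁺ n))) ⟨
          m · (f (mk⁺ n) * 1#)   ≈⟨ ×-comm-* m (f (mk⁺ n)) 1# ⟨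
          f (mk⁺ n) * m · 1#     ≈⟨ *-congˡ fm≈m ⟨
          f (mk⁺ n) * f (mk⁺ m)  ≈⟨ f-* (mk⁺ n) (mk⁺ m) n⊥m ⟨
          f (mk⁺ n *⁺ mk⁺ m)     ≈⟨ fnm≈nm {{ℕ.m*n≢0 n m}} ⟩
          (n ℕ.* m) · 1#         ≈⟨ ×-congˡ (ℕ.*-comm n m) ⟩
          (m ℕ.* n) · 1#         ≈⟨ ×-assocˡ 1# m n ⟨
          m · (n · 1#)           ∎

    f≈id : 3 ℕ.≤ k → ∀ n → f n ≈ value n · 1#
    f≈id 3≤k (mk⁺ n) = closed-all k 3≤k (fixed-closed 3≤k) n

-- The complex numbers as a torsion-free ring

module ComplexNumbers where

  open CauchyEstimates
  open import Data.Integer.Base as ℤ using (+_)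
  import Data.Integer.Properties as ℤ
  open import Data.Rational.Base as ℚ using (ℚ; mkℚ; 0ℚ; 1ℚ; ∣_∣)
  import Data.Rational.Properties as ℚ
  open import Data.Rational.Solver using (module +-*-Solver)
  open ≡ using (sym; trans; cong; subst)

  -- Equality of Cauchy reals and its congruences

  ≡⇒≈ℝ : ∀ {x y} → (∀ n → seq x n ≡ seq y n) → x ≈ℝ y
  ≡⇒≈ℝ {x} {y} x≡y = mk≈ℝ λ ε → 0 , λ n _ →
    subst (λ d → ∣ d ∣ ℚ.< ε) (sym (trans (cong (ℚ._- seq y n) (x≡y n)) (ℚ.+-inverseʳ (seq y n)))) (ℚ.positive⁻¹ ε)

  ≈ℝ-sym : ∀ {x y} → x ≈ℝ y → y ≈ℝ x
  ≈ℝ-sym {x} {y} (mk≈ℝ x≈y) = mk≈ℝ λ ε → let N , h = x≈y ε in N , λ n N≤n →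
    subst (ℚ._< ε) (trans (sym (ℚ.∣-p∣≡∣p∣ (seq x n ℚ.- seq y n)))
      (cong ∣_∣ (solve 2 (λ p q → :- (p :- q) := q :- p) refl (seq x n) (seq y n)))) (h n N≤n)
    where open +-*-Solver

  -- A sum of two null sequences is null. Transitivity and the congruences of addition and negation
  -- are all instances, each with its own way of writing z - w as such a sum.
  sum-≈ℝ : ∀ (x x′ y y′ : ℝ) z w → x ≈ℝ x′ → y ≈ℝ y′ →
    (∀ n → (seq x n ℚ.- seq x′ n) ℚ.+ (seq y n ℚ.- seq y′ n) ≡ seq z n ℚ.- seq w n) → z ≈ℝ w
  sum-≈ℝ x x′ y y′ z w (mk≈ℝ x≈x′) (mk≈ℝ y≈y′) eq = mk≈ℝ λ ε →
    let M , hx = x≈x′ (half ε) {{half-pos ε}}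
        N , hy = y≈y′ (half ε) {{half-pos ε}}
    in M ℕ.⊔ N , λ n n≥ → subst (λ d → ∣ d ∣ ℚ.< ε) (eq n)
         (+-<-half ε (seq x n ℚ.- seq x′ n) (seq y n ℚ.- seq y′ n)
           (hx n (ℕ.m⊔n≤o⇒m≤o M N n≥)) (hy n (ℕ.m⊔n≤o⇒n≤o M N n≥)))

  ≈ℝ-trans : ∀ {x y z} → x ≈ℝ y → y ≈ℝ z → x ≈ℝ z
  ≈ℝ-trans {x} {y} {z} x≈y y≈z = sum-≈ℝ x y y z x z x≈y y≈z λ n →
    solve 3 (λ p q r → (p :- q) :+ (q :- r) := p :- r) refl (seq x n) (seq y n) (seq z n)
    where open +-*-Solver

  +ℝ-cong : ∀ {x x′ y y′} → x ≈ℝ x′ → y ≈ℝ y′ → x +ℝ y ≈ℝ x′ +ℝ y′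
  +ℝ-cong {x} {x′} {y} {y′} x≈x′ y≈y′ = sum-≈ℝ x x′ y y′ (x +ℝ y) (x′ +ℝ y′) x≈x′ y≈y′ λ n →
    solve 4 (λ p p′ q q′ → (p :- p′) :+ (q :- q′) := (p :+ q) :- (p′ :+ q′)) refl
      (seq x n) (seq x′ n) (seq y n) (seq y′ n)
    where open +-*-Solver

  -ℝ-cong : ∀ {x y} → x ≈ℝ y → -ℝ x ≈ℝ -ℝ y
  -ℝ-cong {x} {y} x≈y = sum-≈ℝ y x x x (-ℝ x) (-ℝ y) (≈ℝ-sym x≈y) (≡⇒≈ℝ λ _ → refl) λ n →
    solve 2 (λ p q → (q :- p) :+ (p :- p) := (:- p) :- (:- q)) refl (seq x n) (seq y n)
    where open +-*-Solver

  -- From xy - x′y′ = x(y - y′) + y′(x - x′); this is why bounds are needed for x and y′.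
  *ℝ-cong : ∀ {x x′ y y′} → x ≈ℝ x′ → y ≈ℝ y′ → x *ℝ y ≈ℝ x′ *ℝ y′
  *ℝ-cong {x} {x′} {y} {y′} (mk≈ℝ x≈x′) (mk≈ℝ y≈y′) = mk≈ℝ λ ε →
    let A , A>0 , K , x<A  = eventuallyBounded (seq x) (cauchy x)
        B , B>0 , L , y′<B = eventuallyBounded (seq y′) (cauchy y′)
        M , hx = x≈x′ (δ B {{B>0}} (half ε)) {{δ-pos B {{B>0}} (half ε) {{half-pos ε}}}}
        N , hy = y≈y′ (δ A {{A>0}} (half ε)) {{δ-pos A {{A>0}} (half ε) {{half-pos ε}}}}
    in (K ℕ.⊔ L) ℕ.⊔ (M ℕ.⊔ N) , λ n n≥ →
      let KL≤n = ℕ.m⊔n≤o⇒m≤o (K ℕ.⊔ L) (M ℕ.⊔ N) n≥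
          MN≤n = ℕ.m⊔n≤o⇒n≤o (K ℕ.⊔ L) (M ℕ.⊔ N) n≥
      in *-close A {{A>0}} B {{B>0}} ε (seq x n) (seq x′ n) (seq y n) (seq y′ n)
           (x<A n (ℕ.m⊔n≤o⇒m≤o K L KL≤n)) (y′<B n (ℕ.m⊔n≤o⇒n≤o K L KL≤n))
           (hx n (ℕ.m⊔n≤o⇒m≤o M N MN≤n)) (hy n (ℕ.m⊔n≤o⇒n≤o M N MN≤n))

  ≡⇒≈ℂ : ∀ {z w} → (∀ n → seq (re z) n ≡ seq (re w) n) → (∀ n → seq (im z) n ≡ seq (im w) n) → z ≈ℂ w
  ≡⇒≈ℂ re≡ im≡ = mk≈ℂ (≡⇒≈ℝ re≡) (≡⇒≈ℝ im≡)

  -- Ring laws of ℂ, checked term by term in ℚ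

  module _ where
    open +-*-Solver
    private
      rℂ iℂ : ℂ → ℕ → ℚ
      rℂ z = seq (re z)
      iℂ z = seq (im z)

    *ℂ-comm : ∀ z w → z *ℂ w ≈ℂ w *ℂ z
    *ℂ-comm z w = ≡⇒≈ℂ
      (λ n → solve 4 (λ a b c d → a :* c :- b :* d := c :* a :- d :* b) refl (rℂ z n) (iℂ z n) (rℂ w n) (iℂ w n))
      (λ n → solve 4 (λ a b c d → a :* d :+ b :* c := c :* b :+ d :* a) refl (rℂ z n) (iℂ z n) (rℂ w n) (iℂ w n))

    *ℂ-assoc : ∀ z w v → (z *ℂ w) *ℂ v ≈ℂ z *ℂ (w *ℂ v)
    *ℂ-assoc z w v = ≡⇒≈ℂ
      (λ n → solve 6 (λ a b c d e f → (a :* c :- b :* d) :* e :- (a :* d :+ b :* c) :* f :=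
                                      a :* (c :* e :- d :* f) :- b :* (c :* f :+ d :* e)) refl
                     (rℂ z n) (iℂ z n) (rℂ w n) (iℂ w n) (rℂ v n) (iℂ v n))
      (λ n → solve 6 (λ a b c d e f → (a :* c :- b :* d) :* f :+ (a :* d :+ b :* c) :* e :=
                                      a :* (c :* f :+ d :* e) :+ b :* (c :* e :- d :* f)) refl
                     (rℂ z n) (iℂ z n) (rℂ w n) (iℂ w n) (rℂ v n) (iℂ v n))

    *ℂ-identityˡ : ∀ z → 1ℂ *ℂ z ≈ℂ z
    *ℂ-identityˡ z = ≡⇒≈ℂ
      (λ n → solve 2 (λ a b → con 1ℚ :* a :- con 0ℚ :* b := a) refl (rℂ z n) (iℂ z n))
      (λ n → solve 2 (λ a b → con 1ℚ :* b :+ con 0ℚ :* a := b) refl (rℂ z n) (iℂ z n))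

    *ℂ-distribˡ-+ℂ : ∀ z w v → z *ℂ (w +ℂ v) ≈ℂ z *ℂ w +ℂ z *ℂ v
    *ℂ-distribˡ-+ℂ z w v = ≡⇒≈ℂ
      (λ n → solve 6 (λ a b c d e f → a :* (c :+ e) :- b :* (d :+ f) := (a :* c :- b :* d) :+ (a :* e :- b :* f)) refl
                     (rℂ z n) (iℂ z n) (rℂ w n) (iℂ w n) (rℂ v n) (iℂ v n))
      (λ n → solve 6 (λ a b c d e f → a :* (d :+ f) :+ b :* (c :+ e) := (a :* d :+ b :* c) :+ (a :* f :+ b :* e)) refl
                     (rℂ z n) (iℂ z n) (rℂ w n) (iℂ w n) (rℂ v n) (iℂ v n))

  ≈ℂ-refl : ∀ {z} → z ≈ℂ z
  ≈ℂ-refl = ≡⇒≈ℂ (λ _ → refl) (λ _ → refl)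

  ≈ℂ-sym : ∀ {z w} → z ≈ℂ w → w ≈ℂ z
  ≈ℂ-sym (mk≈ℂ r i) = mk≈ℂ (≈ℝ-sym r) (≈ℝ-sym i)

  ≈ℂ-trans : ∀ {z w v} → z ≈ℂ w → w ≈ℂ v → z ≈ℂ v
  ≈ℂ-trans (mk≈ℂ r i) (mk≈ℂ r′ i′) = mk≈ℂ (≈ℝ-trans r r′) (≈ℝ-trans i i′)

  +ℂ-cong : ∀ {z z′ w w′} → z ≈ℂ z′ → w ≈ℂ w′ → z +ℂ w ≈ℂ z′ +ℂ w′
  +ℂ-cong (mk≈ℂ r i) (mk≈ℂ r′ i′) = mk≈ℂ (+ℝ-cong r r′) (+ℝ-cong i i′)

  *ℂ-cong : ∀ {z z′ w w′} → z ≈ℂ z′ → w ≈ℂ w′ → z *ℂ w ≈ℂ z′ *ℂ w′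
  *ℂ-cong (mk≈ℂ r i) (mk≈ℂ r′ i′) =
    mk≈ℂ (+ℝ-cong (*ℝ-cong r r′) (-ℝ-cong (*ℝ-cong i i′))) (+ℝ-cong (*ℝ-cong r i′) (*ℝ-cong i r′))

  +ℂ-comm : ∀ z w → z +ℂ w ≈ℂ w +ℂ z
  +ℂ-comm z w = ≡⇒≈ℂ (λ n → ℚ.+-comm (seq (re z) n) (seq (re w) n)) (λ n → ℚ.+-comm (seq (im z) n) (seq (im w) n))

  +ℂ-assoc : ∀ z w v → (z +ℂ w) +ℂ v ≈ℂ z +ℂ (w +ℂ v)
  +ℂ-assoc z w v = ≡⇒≈ℂ (λ n → ℚ.+-assoc (seq (re z) n) (seq (re w) n) (seq (re v) n))
                           (λ n → ℚ.+-assoc (seq (im z) n) (seq (im w) n) (seq (im v) n))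

  +ℂ-identityˡ : ∀ z → 0ℂ +ℂ z ≈ℂ z
  +ℂ-identityˡ z = ≡⇒≈ℂ (λ n → ℚ.+-identityˡ (seq (re z) n)) (λ n → ℚ.+-identityˡ (seq (im z) n))

  +ℂ-inverseˡ : ∀ z → (-ℂ z) +ℂ z ≈ℂ 0ℂ
  +ℂ-inverseˡ z = ≡⇒≈ℂ (λ n → ℚ.+-inverseˡ (seq (re z) n)) (λ n → ℚ.+-inverseˡ (seq (im z) n))

  ℂ-isCommutativeRing : IsCommutativeRing _≈ℂ_ _+ℂ_ _*ℂ_ -ℂ_ 0ℂ 1ℂ
  ℂ-isCommutativeRing = record
    { isRing = record
      { +-isAbelianGroup = record
        { isGroup = record
          { isMonoid = record
            { isSemigroup = record
              { isMagma = record
                { isEquivalence = record { refl = ≈ℂ-refl ; sym = ≈ℂ-sym ; trans = ≈ℂ-trans }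
                ; ∙-cong = +ℂ-cong
                }
              ; assoc = +ℂ-assoc
              }
            ; identity = +ℂ-identityˡ , λ z → ≈ℂ-trans (+ℂ-comm z 0ℂ) (+ℂ-identityˡ z)
            }
          ; inverse = +ℂ-inverseˡ , λ z → ≈ℂ-trans (+ℂ-comm z (-ℂ z)) (+ℂ-inverseˡ z)
          ; ⁻¹-cong = λ (mk≈ℂ r i) → mk≈ℂ (-ℝ-cong r) (-ℝ-cong i)
          }
        ; comm = +ℂ-comm
        }
      ; *-cong = *ℂ-cong
      ; *-assoc = *ℂ-assoc
      ; *-identity = *ℂ-identityˡ , λ z → ≈ℂ-trans (*ℂ-comm z 1ℂ) (*ℂ-identityˡ z)
      ; distrib = *ℂ-distribˡ-+ℂ , λ z w v → ≈ℂ-trans (*ℂ-comm (w +ℂ v) z)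
          (≈ℂ-trans (*ℂ-distribˡ-+ℂ z w v) (+ℂ-cong (*ℂ-comm z w) (*ℂ-comm z v)))
      }
    ; *-comm = *ℂ-comm
    }

  ℂ-commutativeRing : CommutativeRing 0ℓ 0ℓ
  ℂ-commutativeRing = record { RawRing ℂ-rawRing ; isCommutativeRing = ℂ-isCommutativeRing }

  -- Torsion-freeness of ℂ and the embedding of the integers

  open Algebra.Definitions.RawSemiring (RawRing.rawSemiring ℂ-rawRing) using () renaming (_×_ to _·ℂ_)
  open Algebra.Definitions.RawMonoid ℚ.+-0-rawMonoid using () renaming (_×_ to _·ℚ_)

  re-· : ∀ m z n → seq (re (m ·ℂ z)) n ≡ m ·ℚ seq (re z) n
  re-· zero    z n = refl
  re-· (suc m) z n = cong (ℚ._+_ (seq (re z) n)) (re-· m z n)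

  im-· : ∀ m z n → seq (im (m ·ℂ z)) n ≡ m ·ℚ seq (im z) n
  im-· zero    z n = refl
  im-· (suc m) z n = cong (ℚ._+_ (seq (im z) n)) (im-· m z n)

  0≤m·1 : ∀ m → 0ℚ ℚ.≤ m ·ℚ 1ℚ
  0≤m·1 zero    = ℚ.≤-refl
  0≤m·1 (suc m) = ℚ.+-mono-≤ {0ℚ} {1ℚ} (ℚ.nonNegative⁻¹ 1ℚ) (0≤m·1 m)

  -- The multiple is the product of q with the rational (1 + m) · 1 ≥ 1.
  ∣q∣≤∣1+m·q∣ : ∀ m q → ∣ q ∣ ℚ.≤ ∣ suc m ·ℚ q ∣
  ∣q∣≤∣1+m·q∣ m q = begin
    ∣ q ∣                     ≡⟨ ℚ.*-identityˡ ∣ q ∣ ⟨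
    1ℚ ℚ.* ∣ q ∣
      ≤⟨ ℚ.*-monoʳ-≤-nonNeg ∣ q ∣ {{ℚ.∣-∣-nonNeg q}} (ℚ.+-mono-≤ {1ℚ} {1ℚ} ℚ.≤-refl (0≤m·1 m)) ⟩
    (suc m ·ℚ 1ℚ) ℚ.* ∣ q ∣   ≡⟨ cong (ℚ._* ∣ q ∣) (ℚ.0≤p⇒∣p∣≡p (0≤m·1 (suc m))) ⟨
    ∣ suc m ·ℚ 1ℚ ∣ ℚ.* ∣ q ∣ ≡⟨ ℚ.∣p*q∣≡∣p∣*∣q∣ (suc m ·ℚ 1ℚ) q ⟨
    ∣ (suc m ·ℚ 1ℚ) ℚ.* q ∣   ≡⟨ cong ∣_∣ (trans (×-assoc-* (suc m) 1ℚ q) (cong (suc m ·ℚ_) (ℚ.*-identityˡ q))) ⟩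
    ∣ suc m ·ℚ q ∣            ∎
    where
    open ℚ.≤-Reasoning
    open Algebra.Properties.Semiring.Mult (CommutativeRing.semiring ℚ.+-*-commutativeRing) using (×-assoc-*)

  -- The terms of x are no larger in absolute value than those of y, so the threshold that works for
  -- y and ε works for x unchanged.
  ·-cancel : ∀ m x y → (∀ n → seq y n ≡ suc m ·ℚ seq x n) → y ≈ℝ fromℚ 0ℚ → x ≈ℝ fromℚ 0ℚ
  ·-cancel m x y y≡ (mk≈ℝ y→0) = mk≈ℝ λ ε → let N , h = y→0 ε in N , λ n N≤n → begin-strict
    ∣ seq x n ℚ.- 0ℚ ∣          ≡⟨ cong ∣_∣ (ℚ.+-identityʳ (seq x n)) ⟩
    ∣ seq x n ∣                 ≤⟨ ∣q∣≤∣1+m·q∣ m (seq x n) ⟩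
    ∣ suc m ·ℚ seq x n ∣        ≡⟨ cong ∣_∣ (trans (ℚ.+-identityʳ (seq y n)) (y≡ n)) ⟨
    ∣ seq y n ℚ.- 0ℚ ∣          <⟨ h n N≤n ⟩
    ε                           ∎
    where open ℚ.≤-Reasoning

  ℂ-torsionFree : TorsionFree ℂ-commutativeRing
  ℂ-torsionFree m z (mk≈ℂ r i) =
    mk≈ℂ (·-cancel m (re z) (re (suc m ·ℂ z)) (re-· (suc m) z) r)
         (·-cancel m (im z) (im (suc m ·ℂ z)) (im-· (suc m) z) i)

  m·1≡m/1 : ∀ m → m ·ℚ 1ℚ ≡ + m ℚ./ 1
  m·1≡m/1 zero    = refl
  -- Replacing the normalised fraction m / 1 by an explicit `mkℚ` lets the addition compute to (1 +
  -- m · 1) / 1.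
  m·1≡m/1 (suc m) = trans (cong (ℚ._+_ 1ℚ) (trans (m·1≡m/1 m) (ℚ.↥p/↧p≡p m/1)))
    (cong (λ i → (+ 1 ℤ.+ i) ℚ./ 1) (ℤ.*-identityʳ (+ m)))
    where
    m/1 : ℚ
    m/1 = mkℚ (+ m) 0 (Coprime.sym (Coprime.1-coprimeTo m))

  m·0≡0 : ∀ m → m ·ℚ 0ℚ ≡ 0ℚ
  m·0≡0 zero    = refl
  m·0≡0 (suc m) = trans (ℚ.+-identityˡ (m ·ℚ 0ℚ)) (m·0≡0 m)

  ·1≈fromℕ⁺ : ∀ n → value n ·ℂ 1ℂ ≈ℂ fromℕ⁺ n
  ·1≈fromℕ⁺ n = ≡⇒≈ℂ (λ i → trans (re-· (value n) 1ℂ i) (m·1≡m/1 (value n)))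
                      (λ i → trans (im-· (value n) 1ℂ i) (m·0≡0 (value n)))

open ComplexNumbers

mainTheorem1 : (k : ℕ) (k≥3 : 3 ≤ k) (f : ℕ⁺ → ℂ) → IsMultiplicative f →
    ((x : Fin k → ℕ⁺) →
    f (sumOfSquares {{>-nonZero (≤-trans (s≤s z≤n) k≥3)}} x) ≈ℂ sumℂ (λ i → f (x i) ^ℂ 2)) →
    (n : ℕ⁺) → f n ≈ℂ fromℕ⁺ n
mainTheorem1 k k≥3 f f-mult f-Σ² n =
  ≈ℂ-trans (f≈id k {{>-nonZero (≤-trans (s≤s z≤n) k≥3)}} f 1-homo *-homo f-Σ² k≥3 n) (·1≈fromℕ⁺ n)
  where
  open IsMultiplicative f-mult
  open InTorsionFreeRing ℂ-commutativeRing ℂ-torsionFree using (f≈id)
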